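{- Let $k\ge 2d$, $0<\varepsilon\le 1/24$ and $\sigma\ge(kz/\varepsilon)^2$. Any deterministic $(1\pm\varepsilon)$-approximation algorithm in the sliding-window model that adheres to the lower-bound model described in the context and solves the $k$-center problem with $z$ outliers in the metric space $(\mathbb{R}^d,L_\infty)$ must use $\Omega((kz/\varepsilon^d)\log\sigma)$ space, where $\sigma$ is the ratio of the largest and smallest distance between any two points in the stream.
   Context: Problem. $L_\infty(p,q)=\max_{1\le i\le d}|p_i-q_i|$ for $p,q\in\mathbb{R}^d$; $d$ is a fixed constant. For a finite point set $P$, $\mathrm{opt}_{k,z}(P)$ is the minimum radius of $k$ congruent balls covering all but at most $z$ points of $P$. Sliding window. $P=\langle p_1,p_2,\dots\rangle$ is a (possibly infinite) stream of points. A point $p_i$ arrives at time $t_{\mathrm{arr}}(p_i)$ and expires at time $t_{\mathrm{exp}}(p_i)=t_{\mathrm{arr}}(p_i)+W$, where $W$ is the given window length; $P(t)$ is the set of points that have arrived and not expired at time $t$. The algorithm must at every time $t$ report a $(1\pm\varepsilon)$-approximation of $\mathrm{opt}_{k,z}(P(t))$. Lower-bound model. Let $S(t)$ be the collection of objects stored at time $t$ (points, weighted points, balls, or anything else). The conditions are: (i) Each object in $S(t)$ is accompanied by an expiration time, equal to the expiration time of some point $p_i\in P(t)$. (ii) Let $p_i\in P(t)$. If no object in $S(t)$ uses $t_{\mathrm{exp}}(p_i)$ as its expiration time, then no object in $S(t')$ with $t'>t$ can use $t_{\mathrm{exp}}(p_i)$ as its expiration time. (iii) The solution reported by the algorithm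 is uniquely determined by $S(t)$, and the algorithm only modifies $S(t)$ when a new point arrives or when an object in $S(t)$ expires. (iv) The algorithm is deterministic and oblivious of future arrivals: $S(t)$ is uniquely determined by the sequence of arrivals up to time $t$, and the solution reported for $P(t)$ is uniquely determined by $S(t)$. The space used is the number of objects in $S(t)$ (the algorithm may keep unbounded extra information to decide which objects to keep); the space bound is for the worst case over streams and times. $\Omega(\cdot)$ hides constants depending only on $d$. -}

module Defs where

open import Level using (0ℓ)
open import Algebra.Bundles using (CommutativeRing; Semiring)
open import Algebra.Core using (Op₁; Op₂)
open import Algebra.Structures using (IsCommutativeRing)
import Algebra.Construct.NaturalChoice.Max as Max
import Algebra.Definitions.RawSemiring as RawSemiring
open import Data.Fin using (Fin; toℕ)
open import Data.List using (List; length)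
open import Data.List.Membership.Propositional using (_∈_)
open import Data.List.Relation.Unary.All using (All)
import Data.List.Relation.Binary.Permutation.Setoid as Permutation
open import Data.Maybe using (Maybe; just; nothing)
open import Data.Nat as ℕ using (ℕ)
open import Data.Product using (_×_; ∃; ∃-syntax; Σ-syntax; proj₂)
open import Data.Product.Relation.Binary.Pointwise.NonDependent using (×-setoid)
open import Data.Sum using (_⊎_)
open import Data.Vec.Functional using (Vector; foldr)
open import Function.Bundles using (_⇔_)
open import Relation.Binary.Bundles using (Setoid; DecTotalOrder)
open import Relation.Binary.Core using (Rel)
import Relation.Binary.Construct.NonStrictToStrict as ToStrict
open import Relation.Binary.PropositionalEquality using (_≡_; _≢_)
open import Relation.Binary.Structures using (IsDecTotalOrder)
open import Relation.Nullary using (¬_)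

record OrderedField : Set₁ where
  infix  4 _≈_ _≤_
  infixl 6 _+_ _-_
  infixl 7 _*_ _/_
  infix  8 -_
  infix  9 _⁻¹
  field
    Carrier           : Set
    _≈_ _≤_           : Rel Carrier 0ℓ
    _+_ _*_           : Op₂ Carrier
    -_ _⁻¹            : Op₁ Carrier
    0# 1#             : Carrier
    isCommutativeRing : IsCommutativeRing _≈_ _+_ _*_ -_ 0# 1#
    isDecTotalOrder   : IsDecTotalOrder _≈_ _≤_
    0≉1               : ¬ 0# ≈ 1#
    ⁻¹-cong           : ∀ {x y} → x ≈ y → x ⁻¹ ≈ y ⁻¹
    -- The value of 0# ⁻¹ is unspecified.
    *-inverseʳ        : ∀ x → ¬ x ≈ 0# → x * x ⁻¹ ≈ 1#
    +-monoˡ-≤         : ∀ z {x y} → x ≤ y → x + z ≤ y + z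
    *-nonneg          : ∀ {x y} → 0# ≤ x → 0# ≤ y → 0# ≤ x * y

  commutativeRing : CommutativeRing 0ℓ 0ℓ
  commutativeRing = record { isCommutativeRing = isCommutativeRing }

  decTotalOrder : DecTotalOrder 0ℓ 0ℓ 0ℓ
  decTotalOrder = record { isDecTotalOrder = isDecTotalOrder }

  open CommutativeRing commutativeRing public using (setoid; semiring)
  open DecTotalOrder decTotalOrder public using (totalOrder)
  open RawSemiring (Semiring.rawSemiring semiring) public
    using (_^_) renaming (_×_ to _×ᴿ_)
  open Max totalOrder public using (_⊔_)
  open ToStrict _≈_ _≤_ public using () renaming (_<_ to infix 4 _<_)

  fromℕ : ℕ → Carrier
  fromℕ n = n ×ᴿ 1#

  _-_ : Op₂ Carrier
  x - y = x + - y

  _/_ : Op₂ Carrier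
  x / y = x * y ⁻¹

  ∣_∣ : Op₁ Carrier
  ∣ x ∣ = x ⊔ (- x)

  UpperBound : (Carrier → Set) → Carrier → Set
  UpperBound Q b = ∀ x → Q x → x ≤ b

  -- ℓ = log₂ x for x > 0: a rational (m - n) / q is at most ℓ exactly when
  -- 2 ^ ((m - n) / q) ≤ x.
  IsLog₂ : Carrier → Carrier → Set
  IsLog₂ x ℓ = ∀ m n q → q ℕ.> 0 →
    (fromℕ 2 ^ m ≤ fromℕ 2 ^ n * x ^ q) ⇔ (fromℕ m ≤ fromℕ n + fromℕ q * ℓ)

-- The real numbers, axiomatised as a complete Archimedean ordered field.
-- Classically such a field is unique up to isomorphism.  The order is decidable,
-- as it is for ℝ in classical mathematics; given excluded middle, the setoid of
-- Cauchy sequences of rationals is a model.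
record RealField : Set₁ where
  field
    orderedField : OrderedField
  open OrderedField orderedField public
  field
    archimedean : ∀ x → ∃[ n ] x ≤ fromℕ n
    complete    : ∀ (Q : Carrier → Set) → ∃ Q → ∃ (UpperBound Q) →
                  ∃[ s ] UpperBound Q s × (∀ b → UpperBound Q b → s ≤ b)

module SlidingWindow (ℝ : RealField) where

  open RealField ℝ

  Time : Set
  Time = Carrier

  Point : ℕ → Set
  Point d = Vector Carrier d

  L∞ : ∀ {d} → Point d → Point d → Carrier
  L∞ p q = foldr _⊔_ 0# (λ i → ∣ p i - q i ∣)

  -- `nothing` is the length of an infinite stream.
  Index : Maybe ℕ → Set
  Index (just n) = Fin n
  Index nothing  = ℕ

  rank : ∀ len → Index len → ℕ
  rank (just n) i = toℕ i
  rank nothing  i = i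

  record Stream (d : ℕ) : Set where
    field
      len   : Maybe ℕ
      point : Index len → Point d
      arr   : Index len → Time
      arr-mono      : ∀ i j → rank len i ℕ.< rank len j → arr i ≤ arr j
      -- Only finitely many points have arrived at any given time.
      locallyFinite : ∀ t → ∃[ n ] ∀ i → arr i ≤ t → rank len i ℕ.< n

    -- The n-th point of the stream is x and arrives at time τ.
    Arrival : ℕ → Point d → Time → Set
    Arrival n x τ = ∃[ i ] rank len i ≡ n × (∀ a → point i a ≈ x a) × arr i ≈ τ

  open Stream using (len; point; arr; Arrival)

  SameUpTo : ∀ {d} → Time → Stream d → Stream d → Set
  SameUpTo t P P′ = ∀ n x τ → τ ≤ t → Arrival P n x τ ⇔ Arrival P′ n x τ

  -- σ is the ratio of the largest and the smallest distance between two points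
  -- of P; in particular no two points of P coincide.
  record HasSpread {d} (P : Stream d) (σ : Carrier) : Set where
    field
      smallest largest  : Carrier
      smallest-positive : 0# < smallest
      smallest-attained : ∃[ i ] ∃[ j ] i ≢ j × L∞ (point P i) (point P j) ≈ smallest
      largest-attained  : ∃[ i ] ∃[ j ] i ≢ j × L∞ (point P i) (point P j) ≈ largest
      smallest-≤        : ∀ i j → i ≢ j → smallest ≤ L∞ (point P i) (point P j)
      ≤-largest         : ∀ i j → i ≢ j → L∞ (point P i) (point P j) ≤ largest
      ratio             : σ ≈ largest / smallest

  module _ (W : Time) where

    exp : ∀ {d} (P : Stream d) → Index (len P) → Time
    exp P i = arr P i + W

    -- The i-th point of P belongs to P(t).
    Active : ∀ {d} (P : Stream d) → Time → Index (len P) → Set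
    Active P t i = arr P i ≤ t × t < exp P i

    Covers : ∀ {d} → ℕ → ℕ → Stream d → Time → Carrier → Set
    Covers {d} k z P t r =
      Σ[ centers ∈ (Fin k → Point d) ] Σ[ outliers ∈ List (Index (len P)) ]
        length outliers ℕ.≤ z ×
        (∀ i → Active P t i →
          i ∈ outliers ⊎ (∃[ j ] L∞ (point P i) (centers j) ≤ r))

    record IsOpt {d} (k z : ℕ) (P : Stream d) (t : Time) (r : Carrier) : Set where
      field
        nonneg  : 0# ≤ r
        covers  : Covers k z P t r
        minimal : ∀ r′ → 0# ≤ r′ → Covers k z P t r′ → r ≤ r′

  -- The type of stored objects carries the algorithm's own notion of equality.
  -- Objects are tagged with their expiration time, and `S P t` is the collection
  -- S(t), taken up to permutation.  `S` may depend on the whole stream here;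
  -- obliviousness of future arrivals is imposed in `Adheres`.
  record Algorithm (d : ℕ) : Set₁ where
    field
      object : Setoid 0ℓ 0ℓ

    Stored : Set
    Stored = Setoid.Carrier object × Time

    open Permutation (×-setoid object setoid) public using (_↭_)

    field
      S      : Stream d → Time → List Stored
      report : List Stored → Carrier

    -- No object stored at time t has expiration time e.
    Unused : Stream d → Time → Time → Set
    Unused P t e = All (λ o → ¬ proj₂ o ≈ e) (S P t)

  record Adheres {d} (W : Time) (A : Algorithm d) : Set where
    open Algorithm A
    field
      expiration : ∀ P t →
        All (λ o → ∃[ i ] Active W P t i × proj₂ o ≈ exp W P i) (S P t)
      no-reuse : ∀ P t i → Active W P t i → Unused P t (exp W P i) →
        ∀ t′ → t < t′ → Unused P t′ (exp W P i)
      lazy : ∀ P t t′ → t < t′ →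
        (∀ i → ¬ (t < arr P i × arr P i ≤ t′)) →
        All (λ o → ¬ (t < proj₂ o × proj₂ o ≤ t′)) (S P t) →
        S P t′ ↭ S P t
      oblivious : ∀ P P′ t → SameUpTo t P P′ → S P t ↭ S P′ t
      report-determined : ∀ {xs ys} → xs ↭ ys → report xs ≈ report ys

  -- Correctness and space usage both refer to the streams of spread σ, so an
  -- algorithm may be tailored to σ (as well as to k, z, ε and W).
  module _ {d} (σ : Carrier) (A : Algorithm d) where

    open Algorithm A

    Solves : (W : Time) (k z : ℕ) (ε : Carrier) → Set
    Solves W k z ε = ∀ P → HasSpread P σ → ∀ t opt → IsOpt W k z P t opt →
      (1# - ε) * opt ≤ report (S P t) × report (S P t) ≤ (1# + ε) * opt

    SpaceBound : ℕ → Set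
    SpaceBound s = ∀ P → HasSpread P σ → ∀ t → length (S P t) ℕ.≤ s

{-# OPTIONS --safe #-}
module Submission where

-- If no stored object carries the expiration time of some point, then the report
-- cannot change when that point expires.  A stream is built in which every point
-- can become the one whose expiration must change the report.  Take κ = k - 2d + 1
-- towers of geometrically growing grids with about (1/ε)ᵈ cells of z points each,
-- coarse grids first.  When the points before p have expired, only finer grids of
-- its tower and the rest of its own grid are left.  Let later arrivals fill up the
-- cell of p to z + 1 points, put z + 1 points into every other tower, and z + 1
-- points at p ± R along each axis, where R slightly exceeds the diameter of the
-- grid.  These k + 1 places are pairwise about R apart, so the radius is at least
-- about R/2.  Once p has expired, its cell can be declared outliers, and every
-- other point of the tower differs from p by a grid step in some coordinate, so
-- that the 2d boxes at the points p ± R, shorter by about half a grid step, cover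
-- the tower.  Grid step and R are in ratio about 4ε, so the optimum drops by a
-- factor more than (1 + ε)/(1 - ε).

open import Defs
open import Data.Nat as ℕ using (ℕ; zero; suc)
open import Data.Product using (_×_; _,_; ∃-syntax; proj₁; proj₂; uncurry)
open import Algebra.Bundles using (CommutativeRing)
import Algebra.Construct.NaturalChoice.Max as Max
import Algebra.Construct.NaturalChoice.MaxOp as MaxOp
import Algebra.Properties.CommutativeSemiring.Exp as Exp
import Algebra.Properties.Ring as RingProperties
import Algebra.Properties.Semiring.Mult as Mult
open import Data.Fin using (Fin; zero; suc; toℕ; fromℕ<; _↑ˡ_; _↑ʳ_; splitAt; join; combine; remQuot; opposite; finToFun; punchIn; punchOut)
import Data.Fin.Properties as Fin
open import Data.List using (List; []; _∷_; length; lookup; map; filter; tabulate; allFin; cartesianProduct)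
import Data.List.Extrema as Extrema
import Data.List.Membership.DecPropositional as DecMembership
open import Data.List.Membership.Propositional using (_∈_; _∉_)
open import Data.List.Membership.Propositional.Properties using (∈-map⁺; ∈-cartesianProduct⁺; ∈-allFin; ∈-filter⁺; ∈-filter⁻; ∈-tabulate⁺)
open import Data.List.Properties using (length-tabulate)
import Data.List.Relation.Binary.Permutation.Setoid.Properties as Permutation
open import Data.List.Relation.Unary.All as All using (All; []; _∷_)
open import Data.List.Relation.Unary.All.Properties using (all-filter; ¬All⇒Any¬)
open import Data.List.Relation.Unary.Any as Any using (Any; here; there)
open import Data.List.Relation.Unary.Any.Properties using (lookup-index)
open import Data.Maybe using (just)
import Data.Nat.Properties as ℕ
open import Data.Nat.Tactic.RingSolver using (solve-∀)
import Data.Product as Product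
open import Data.Product.Relation.Binary.Pointwise.NonDependent using (×-setoid)
open import Data.Sum using (_⊎_; inj₁; inj₂)
import Data.Sum as Sum
import Data.Sum.Properties as Sum
open import Data.Vec.Functional using (Vector; foldr; updateAt; _++_)
open import Data.Vec.Functional.Properties using (lookup-++ˡ; lookup-++-<; updateAt-updates; updateAt-minimal)
open import Function using (_∘_; const; mk⇔; Equivalence)
open import Relation.Binary.Bundles using (DecTotalOrder)
import Relation.Binary.Construct.NonStrictToStrict as ToStrict
open import Relation.Binary.Definitions using (tri<; tri≈; tri>)
open import Relation.Binary.PropositionalEquality as ≡ using (_≡_; _≢_; _≗_)
open import Relation.Nullary using (¬_; Dec; yes; no; contradiction)
open import Relation.Nullary.Decidable using (¬?; decidable-stable)
open import Relation.Unary using (Decidable)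

-- A positive smallest distance forbids coinciding points, so a cell cannot hold z copies of one
-- point. All coordinates are therefore stretched by 2z + 1, and every lattice point becomes a
-- diagonal segment of 2z + 1 slots. Stretching costs less than one lattice unit per distance, which
-- is why R is one more than the value that enters the lower bound.
--
-- The extent of the construction grows like 2^J kz/ε, where 2^J is the largest scale, and it must
-- stay below σ. This leaves about log σ - log(kz/ε) scales, and σ ≥ (kz/ε)² makes that a constant
-- fraction of log σ.
--
-- At scale n the grid step is 4n, and the coordinates of a grid, relative to its tower, lie between
-- 4n(ℓ + 1) and 8nℓ. Halving n moves the upper end to 4nℓ, one full step below the coarser grid, so
-- cells of different scales are as well separated as neighbours in the coarser grid. With 8(ℓ + 1)ε
-- ≤ 1, the quotient (8ℓ + 8)/(8ℓ + 6) of the two radii already exceeds (1 + ε)/(1 - ε).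

-- Arithmetic in ordered fields.

module OrderedFieldProperties (F : OrderedField) where

  open OrderedField F public
  open CommutativeRing commutativeRing public
    using (refl; sym; trans; reflexive; +-cong; +-congˡ; +-congʳ; *-cong; *-congˡ; *-congʳ;
           +-assoc; +-comm; +-identityˡ; +-identityʳ; *-assoc; *-comm;
           *-identityˡ; *-identityʳ; distribˡ; distribʳ; zeroˡ; zeroʳ;
           -‿cong; -‿inverseˡ; -‿inverseʳ; ring; commutativeSemiring)
  open DecTotalOrder decTotalOrder public
    using (_≤?_; _≟_; total; antisym; poset)
    renaming (refl to ≤-refl; trans to ≤-trans; reflexive to ≤-reflexive)
  open RingProperties ring public using (-‿distribʳ-*; -‿+-comm; -‿involutive)
  open Mult semiring public using (×1-homo-*; ×-homo-+)
  open Exp commutativeSemiring public using (^-distrib-*)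
  open MaxOp (Max.maxOperator totalOrder) public
    using (x≤x⊔y; x≤y⊔x; ⊔-lub)
  open import Relation.Binary.Reasoning.PartialOrder poset public
  open import Algebra.Solver.Ring.NaturalCoefficients.Default commutativeSemiring public
    using (solve; _:=_; _:+_; _:*_; con)

  <⇒≤ : ∀ {x y} → x < y → x ≤ y
  <⇒≤ = proj₁

  <⇒≱ : ∀ {x y} → x < y → ¬ y ≤ x
  <⇒≱ = ToStrict.<⇒≱ _≈_ _≤_ antisym

  ≰⇒> : ∀ {x y} → ¬ x ≤ y → y < x
  ≰⇒> = ToStrict.≰⇒> _≈_ _≤_ sym ≤-reflexive total

  ≰⇒≥ : ∀ {x y} → ¬ x ≤ y → y ≤ x
  ≰⇒≥ x≰y = <⇒≤ (≰⇒> x≰y)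

  ≤-<-trans : ∀ {x y z} → x ≤ y → y < z → x < z
  ≤-<-trans = ToStrict.≤-<-trans _≈_ _≤_ ≤-trans antisym (λ x≈y y≤z → ≤-trans (≤-reflexive (sym x≈y)) y≤z)

  <-≤-trans : ∀ {x y z} → x < y → y ≤ z → x < z
  <-≤-trans = ToStrict.<-≤-trans _≈_ _≤_ sym ≤-trans antisym (λ y≈z x≤y → ≤-trans x≤y (≤-reflexive y≈z))

  ≤-resp : ∀ {x x′ y y′} → x ≈ x′ → y ≈ y′ → x ≤ y → x′ ≤ y′
  ≤-resp x≈x′ y≈y′ x≤y = ≤-trans (≤-reflexive (sym x≈x′)) (≤-trans x≤y (≤-reflexive y≈y′))

  +-monoʳ-≤ : ∀ z {x y} → x ≤ y → z + x ≤ z + y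
  +-monoʳ-≤ z x≤y = ≤-resp (+-comm _ z) (+-comm _ z) (+-monoˡ-≤ z x≤y)

  +-mono-≤ : ∀ {x y u v} → x ≤ y → u ≤ v → x + u ≤ y + v
  +-mono-≤ {y = y} {u} x≤y u≤v = ≤-trans (+-monoˡ-≤ u x≤y) (+-monoʳ-≤ y u≤v)

  x-y+y≈x : ∀ x y → x - y + y ≈ x
  x-y+y≈x x y = trans (+-assoc x (- y) y) (trans (+-congˡ (-‿inverseˡ y)) (+-identityʳ x))

  x+y-y≈x : ∀ x y → x + y - y ≈ x
  x+y-y≈x x y = trans (+-assoc x y (- y)) (trans (+-congˡ (-‿inverseʳ y)) (+-identityʳ x))

  +-cancelʳ-≤ : ∀ z {x y} → x + z ≤ y + z → x ≤ y
  +-cancelʳ-≤ z h = ≤-resp (x+y-y≈x _ z) (x+y-y≈x _ z) (+-monoˡ-≤ (- z) h)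

  +-cancelˡ-≤ : ∀ z {x y} → z + x ≤ z + y → x ≤ y
  +-cancelˡ-≤ z h = +-cancelʳ-≤ z (≤-resp (+-comm z _) (+-comm z _) h)

  x≤y+z⇒x-z≤y : ∀ {x y z} → x ≤ y + z → x - z ≤ y
  x≤y+z⇒x-z≤y {x} {y} {z} h = +-cancelʳ-≤ z (≤-resp (sym (x-y+y≈x x z)) refl h)

  x-z≤y⇒x≤y+z : ∀ {x y z} → x - z ≤ y → x ≤ y + z
  x-z≤y⇒x≤y+z {x} {y} {z} h = ≤-resp (x-y+y≈x x z) refl (+-monoˡ-≤ z h)

  x≤y⇒0≤y-x : ∀ {x y} → x ≤ y → 0# ≤ y - x
  x≤y⇒0≤y-x {x} {y} h = ≤-resp (-‿inverseʳ x) refl (+-monoˡ-≤ (- x) h)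

  x≤x+y : ∀ x {y} → 0# ≤ y → x ≤ x + y
  x≤x+y x h = ≤-resp (+-identityʳ x) refl (+-monoʳ-≤ x h)

  *-monoʳ-≤ : ∀ {z} → 0# ≤ z → ∀ {x y} → x ≤ y → z * x ≤ z * y
  *-monoʳ-≤ {z} 0≤z {x} {y} x≤y = +-cancelʳ-≤ (z * - x) (≤-resp lhs (distribˡ z y (- x)) (*-nonneg 0≤z (x≤y⇒0≤y-x x≤y)))
    where
    lhs : 0# ≈ z * x + z * - x
    lhs = trans (sym (zeroʳ z)) (trans (*-congˡ (sym (-‿inverseʳ x))) (distribˡ z x (- x)))

  *-monoˡ-≤ : ∀ {z} → 0# ≤ z → ∀ {x y} → x ≤ y → x * z ≤ y * z
  *-monoˡ-≤ 0≤z x≤y = ≤-resp (*-comm _ _) (*-comm _ _) (*-monoʳ-≤ 0≤z x≤y)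

  *-mono-≤ : ∀ {x y u v} → 0# ≤ x → 0# ≤ v → x ≤ y → u ≤ v → x * u ≤ y * v
  *-mono-≤ 0≤x 0≤v x≤y u≤v = ≤-trans (*-monoʳ-≤ 0≤x u≤v) (*-monoˡ-≤ 0≤v x≤y)

  0≤-x : ∀ {x} → x ≤ 0# → 0# ≤ - x
  0≤-x {x} h = ≤-resp (-‿inverseʳ x) (+-identityˡ (- x)) (+-monoˡ-≤ (- x) h)

  0≤1 : 0# ≤ 1#
  0≤1 with total 0# 1#
  ... | inj₁ 0≤1 = 0≤1
  ... | inj₂ 1≤0 = ≤-resp refl square (*-nonneg (0≤-x 1≤0) (0≤-x 1≤0))
    where
    square : - 1# * - 1# ≈ 1#
    square = trans (sym (-‿distribʳ-* (- 1#) 1#)) (trans (-‿cong (*-identityʳ (- 1#))) (-‿involutive 1#))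

  0<1 : 0# < 1#
  0<1 = 0≤1 , 0≉1

  >⇒≉0 : ∀ {x} → 0# < x → ¬ x ≈ 0#
  >⇒≉0 (_ , 0≉x) x≈0 = 0≉x (sym x≈0)

  *-inverse : ∀ {x} → 0# < x → x * x ⁻¹ ≈ 1#
  *-inverse 0<x = *-inverseʳ _ (>⇒≉0 0<x)

  ⁻¹-nonneg : ∀ {x} → 0# < x → 0# ≤ x ⁻¹
  ⁻¹-nonneg {x} 0<x with total 0# (x ⁻¹)
  ... | inj₁ h = h
  ... | inj₂ h = contradiction 1≤0 (<⇒≱ 0<1)
    where
    -1≥0 : 0# ≤ - 1#
    -1≥0 = ≤-resp refl (trans (sym (-‿distribʳ-* x (x ⁻¹))) (-‿cong (*-inverse 0<x)))
             (*-nonneg (<⇒≤ 0<x) (0≤-x h))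
    1≤0 : 1# ≤ 0#
    1≤0 = ≤-resp (+-identityˡ 1#) (-‿inverseˡ 1#) (+-monoˡ-≤ 1# -1≥0)

  ⁻¹-pos : ∀ {x} → 0# < x → 0# < x ⁻¹
  ⁻¹-pos {x} 0<x = ⁻¹-nonneg 0<x , λ 0≈x⁻¹ →
    0≉1 (trans (sym (zeroʳ x)) (trans (*-congˡ 0≈x⁻¹) (*-inverse 0<x)))

  x*z/z≈x : ∀ {x z} → 0# < z → x * z * z ⁻¹ ≈ x
  x*z/z≈x {x} {z} 0<z = trans (*-assoc x z _) (trans (*-congˡ (*-inverse 0<z)) (*-identityʳ x))

  *-cancelʳ-≤ : ∀ {z} → 0# < z → ∀ {x y} → x * z ≤ y * z → x ≤ y
  *-cancelʳ-≤ {z} 0<z h = ≤-resp (x*z/z≈x 0<z) (x*z/z≈x 0<z) (*-monoˡ-≤ (⁻¹-nonneg 0<z) h)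

  x/z*z≈x : ∀ {x z} → 0# < z → x / z * z ≈ x
  x/z*z≈x {x} {z} 0<z = trans (*-assoc x _ z) (trans (*-congˡ (trans (*-comm _ z) (*-inverse 0<z))) (*-identityʳ x))

  *-cancelʳ-≈ : ∀ {z} → 0# < z → ∀ {x y} → x * z ≈ y * z → x ≈ y
  *-cancelʳ-≈ 0<z h = trans (sym (x*z/z≈x 0<z)) (trans (*-congʳ h) (x*z/z≈x 0<z))

  *-pos : ∀ {x y} → 0# < x → 0# < y → 0# < x * y
  *-pos {x} {y} 0<x 0<y = *-nonneg (<⇒≤ 0<x) (<⇒≤ 0<y) , λ 0≈xy →
    proj₂ 0<x (*-cancelʳ-≈ 0<y (trans (zeroˡ y) 0≈xy))

  x/y-pos : ∀ {x y} → 0# < x → 0# < y → 0# < x / y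
  x/y-pos 0<x 0<y = *-pos 0<x (⁻¹-pos 0<y)

  ^-nonneg : ∀ {x} → 0# ≤ x → ∀ n → 0# ≤ x ^ n
  ^-nonneg 0≤x zero    = 0≤1
  ^-nonneg 0≤x (suc n) = *-nonneg 0≤x (^-nonneg 0≤x n)

  ^-pos : ∀ {x} → 0# < x → ∀ n → 0# < x ^ n
  ^-pos 0<x zero    = 0<1
  ^-pos 0<x (suc n) = *-pos 0<x (^-pos 0<x n)

  1≤x⇒1≤x^n : ∀ {x} → 1# ≤ x → ∀ n → 1# ≤ x ^ n
  1≤x⇒1≤x^n 1≤x zero    = ≤-refl
  1≤x⇒1≤x^n 1≤x (suc n) = ≤-resp (*-identityʳ 1#) refl
    (*-mono-≤ 0≤1 (≤-trans 0≤1 (1≤x⇒1≤x^n 1≤x n)) 1≤x (1≤x⇒1≤x^n 1≤x n))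

  fromℕ-+ : ∀ m n → fromℕ (m ℕ.+ n) ≈ fromℕ m + fromℕ n
  fromℕ-+ m n = ×-homo-+ 1# m n

  fromℕ-* : ∀ m n → fromℕ (m ℕ.* n) ≈ fromℕ m * fromℕ n
  fromℕ-* = ×1-homo-*

  fromℕ-^ : ∀ m n → fromℕ (m ℕ.^ n) ≈ fromℕ m ^ n
  fromℕ-^ m zero    = +-identityʳ 1#
  fromℕ-^ m (suc n) = trans (fromℕ-* m (m ℕ.^ n)) (*-congˡ (fromℕ-^ m n))

  fromℕ-1 : fromℕ 1 ≈ 1#
  fromℕ-1 = +-identityʳ 1#

  fromℕ-nonneg : ∀ n → 0# ≤ fromℕ n
  fromℕ-nonneg zero    = ≤-refl
  fromℕ-nonneg (suc n) = ≤-trans 0≤1 (x≤x+y 1# (fromℕ-nonneg n))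

  fromℕ-mono-≤ : ∀ {m n} → m ℕ.≤ n → fromℕ m ≤ fromℕ n
  fromℕ-mono-≤ {n = n} ℕ.z≤n = fromℕ-nonneg n
  fromℕ-mono-≤ (ℕ.s≤s h) = +-monoʳ-≤ 1# (fromℕ-mono-≤ h)

  fromℕ-cancel-≤ : ∀ {m n} → fromℕ m ≤ fromℕ n → m ℕ.≤ n
  fromℕ-cancel-≤ {zero} h = ℕ.z≤n
  fromℕ-cancel-≤ {suc m} {zero} h =
    contradiction (≤-trans (x≤x+y 1# (fromℕ-nonneg m)) h) (<⇒≱ 0<1)
  fromℕ-cancel-≤ {suc m} {suc n} h = ℕ.s≤s (fromℕ-cancel-≤ (+-cancelˡ-≤ 1# h))

  fromℕ-pos : ∀ {n} → 1 ℕ.≤ n → 0# < fromℕ n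
  fromℕ-pos {n} 1≤n = <-≤-trans 0<1 (≤-resp fromℕ-1 refl (fromℕ-mono-≤ 1≤n))

  ∣x-y∣≤r : ∀ {x y r} → x ≤ y + r → y ≤ x + r → ∣ x - y ∣ ≤ r
  ∣x-y∣≤r {x} {y} {r} h h′ = ⊔-lub (x≤y+z⇒x-z≤y (≤-resp refl (+-comm y r) h))
    (≤-resp (sym neg) refl (x≤y+z⇒x-z≤y (≤-resp refl (+-comm x r) h′)))
    where
    neg : - (x - y) ≈ y - x
    neg = trans (sym (-‿+-comm x (- y))) (trans (+-congˡ (-‿involutive y)) (+-comm (- x) y))

  ∣x-y∣≤r⇒x≤y+r : ∀ {x y r} → ∣ x - y ∣ ≤ r → x ≤ y + r
  ∣x-y∣≤r⇒x≤y+r {x} {y} {r} h = ≤-resp refl (+-comm r y) (x-z≤y⇒x≤y+z (≤-trans (x≤x⊔y _ _) h))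

  ∣x-y∣≤r⇒y≤x+r : ∀ {x y r} → ∣ x - y ∣ ≤ r → y ≤ x + r
  ∣x-y∣≤r⇒y≤x+r {x} {y} {r} h = ≤-resp refl (+-comm r x) (x-z≤y⇒x≤y+z (≤-resp neg refl (≤-trans (x≤y⊔x _ _) h)))
    where
    neg : - (x - y) ≈ y - x
    neg = trans (sym (-‿+-comm x (- y))) (trans (+-congˡ (-‿involutive y)) (+-comm (- x) y))

  foldr-⊔-lub : ∀ {n} (v : Vector Carrier n) {r} → 0# ≤ r → (∀ a → v a ≤ r) → foldr _⊔_ 0# v ≤ r
  foldr-⊔-lub {zero}  v 0≤r h = 0≤r
  foldr-⊔-lub {suc n} v 0≤r h = ⊔-lub (h zero) (foldr-⊔-lub (λ a → v (suc a)) 0≤r (λ a → h (suc a)))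

  foldr-⊔-nonneg : ∀ {n} (v : Vector Carrier n) → 0# ≤ foldr _⊔_ 0# v
  foldr-⊔-nonneg {zero}  v = ≤-refl
  foldr-⊔-nonneg {suc n} v = ≤-trans (foldr-⊔-nonneg (λ a → v (suc a))) (x≤y⊔x _ _)

  ≤-foldr-⊔ : ∀ {n} (v : Vector Carrier n) a → v a ≤ foldr _⊔_ 0# v
  ≤-foldr-⊔ v zero    = x≤x⊔y _ _
  ≤-foldr-⊔ v (suc a) = ≤-trans (≤-foldr-⊔ (λ b → v (suc b)) a) (x≤y⊔x _ _)

-- L∞-balls, finite streams with equally spaced arrivals, existence of optimal radii.

module FiniteStreams (ℝ : RealField) where

  open RealField ℝ using (orderedField; archimedean) public
  open OrderedFieldProperties orderedField public
  open SlidingWindow ℝ public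
  open Extrema totalOrder using (argmin; argmin-sel; f[argmin]≤f[⊤]; f[argmin]≤f[xs]; max; max≤v⁺; argmax-sel; xs≤max; ⊥≤max)

  L∞-lub : ∀ {d} (p q : Point d) {r} → 0# ≤ r →
    (∀ a → p a ≤ q a + r) → (∀ a → q a ≤ p a + r) → L∞ p q ≤ r
  L∞-lub p q 0≤r h h′ = foldr-⊔-lub _ 0≤r (λ a → ∣x-y∣≤r (h a) (h′ a))

  L∞⇒≤ : ∀ {d} (p q : Point d) {r} → L∞ p q ≤ r → ∀ a → p a ≤ q a + r
  L∞⇒≤ p q h a = ∣x-y∣≤r⇒x≤y+r (≤-trans (≤-foldr-⊔ _ a) h)

  L∞⇒≥ : ∀ {d} (p q : Point d) {r} → L∞ p q ≤ r → ∀ a → q a ≤ p a + r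
  L∞⇒≥ p q h a = ∣x-y∣≤r⇒y≤x+r (≤-trans (≤-foldr-⊔ _ a) h)

  same-ball : ∀ {d} (p q c : Point d) {r} → L∞ p c ≤ r → L∞ q c ≤ r →
    ∀ a → p a ≤ q a + (r + r)
  same-ball p q c {r} hp hq a = ≤-resp refl (+-assoc (q a) r r)
    (≤-trans (L∞⇒≤ p c hp a) (+-monoˡ-≤ r (L∞⇒≥ q c hq a)))

  half : Carrier → Carrier
  half x = x / (1# + 1#)

  0<2 : 0# < 1# + 1#
  0<2 = <-≤-trans 0<1 (x≤x+y 1# 0≤1)

  *2 : ∀ x → x * (1# + 1#) ≈ x + x
  *2 = solve 1 (λ x → x :* (con 1 :+ con 1) := x :+ x) refl

  half+half : ∀ x → half x + half x ≈ x
  half+half x = trans (sym (*2 (half x))) (x/z*z≈x 0<2)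

  half-≤ : ∀ {x r} → x ≤ r + r → half x ≤ r
  half-≤ {x} {r} h = *-cancelʳ-≤ 0<2 (≤-resp (sym (x/z*z≈x 0<2)) (sym (*2 r)) h)

  half-≤⁻¹ : ∀ {x r} → half x ≤ r → x ≤ r + r
  half-≤⁻¹ {x} h = ≤-resp (half+half x) refl (+-mono-≤ h h)

  half-nonneg : ∀ {x} → 0# ≤ x → 0# ≤ half x
  half-nonneg 0≤x = *-nonneg 0≤x (⁻¹-nonneg 0<2)

  -- The least value plus c lies within c of all values, as none exceeds the least by more than 2c.
  -- An empty list gets an arbitrary centre.
  midpoint : ∀ {n} (v : Fin n → Carrier) (xs : List (Fin n)) c →
    (∀ {i i′} → i ∈ xs → i′ ∈ xs → v i ≤ v i′ + (c + c)) →
    ∃[ x ] (∀ {i} → i ∈ xs → v i ≤ x + c × x ≤ v i + c)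
  midpoint v [] c h = 0# , λ ()
  midpoint {n} v (i₀ ∷ is) c h = v m + c , λ {i} i∈ →
      ≤-resp refl (sym (+-assoc (v m) c c)) (h i∈ m∈)
    , +-monoˡ-≤ c (All.lookup m≤ i∈)
    where
    m : Fin n
    m = argmin v i₀ is
    m∈ : m ∈ i₀ ∷ is
    m∈ with argmin-sel v i₀ is
    ... | inj₁ eq = here eq
    ... | inj₂ m∈is = there m∈is
    m≤ : All (λ i → v m ≤ v i) (i₀ ∷ is)
    m≤ = f[argmin]≤f[⊤] {f = v} i₀ is ∷ f[argmin]≤f[xs] {f = v} i₀ is

  -- Replaces an arbitrary feasible radius by one of finitely many; `0#` is the value when no member
  -- of R is small enough.
  round-down : ∀ (R : List Carrier) {r} → 0# ≤ r →
    ∃[ c ] c ∈ 0# ∷ R × 0# ≤ c × c ≤ r × (∀ {c′} → c′ ∈ R → c′ ≤ r → c′ ≤ c)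
  round-down R {r} 0≤r = c , c∈ , ⊥≤max 0# R≤r ,
      max≤v⁺ 0≤r (all-filter (_≤? r) R) ,
      λ c′∈ c′≤r → All.lookup (xs≤max 0# R≤r) (∈-filter⁺ (_≤? r) c′∈ c′≤r)
    where
    R≤r = filter (_≤? r) R
    c = max 0# R≤r
    c∈ : c ∈ 0# ∷ R
    c∈ with argmax-sel (λ x → x) 0# R≤r
    ... | inj₁ eq = here eq
    ... | inj₂ ∈R≤r = there (proj₁ (∈-filter⁻ (_≤? r) ∈R≤r))

  -- The infimum of the radii is only used to derive a contradiction, so its
  -- double-negated existence suffices and covers need not be decided.
  ¬¬-em : ∀ (A : Set) → ¬ ¬ (A ⊎ ¬ A)
  ¬¬-em A h = h (inj₂ (λ a → h (inj₁ a)))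

  Least : (Carrier → Set) → List Carrier → Set
  Least Q R = ∃[ c ] Q c × (∀ {c′} → c′ ∈ R → Q c′ → c ≤ c′)

  -- Under a double negation Q may be treated as decidable, one list element at a time.
  ¬¬-least : ∀ (Q : Carrier → Set) R → ¬ ¬ (Least Q R ⊎ (∀ {c} → c ∈ R → ¬ Q c))
  ¬¬-least Q [] h = h (inj₂ λ ())
  ¬¬-least Q (x ∷ R) h = ¬¬-em (Q x) λ where
      (inj₂ ¬qx) → ¬¬-least Q R λ where
        (inj₁ (c , qc , c≤)) → h (inj₁ (c , qc , λ where
          (here ≡.refl) qx → contradiction qx ¬qx
          (there c′∈) qc′ → c≤ c′∈ qc′))
        (inj₂ none) → h (inj₂ λ where
          (here ≡.refl) → ¬qx
          (there c∈) → none c∈)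
      (inj₁ qx) → ¬¬-least Q R λ where
        (inj₂ none) → h (inj₁ (x , qx , λ where
          (here ≡.refl) _ → ≤-refl
          (there c∈) qc → contradiction qc (none c∈)))
        (inj₁ (c , qc , c≤)) → h (inj₁ (smaller qx qc c≤ (total x c)))
    where
    smaller : ∀ {c} → Q x → Q c → (∀ {c′} → c′ ∈ R → Q c′ → c ≤ c′) → x ≤ c ⊎ c ≤ x → Least Q (x ∷ R)
    smaller qx qc c≤ (inj₁ x≤c) = x , qx , λ where
      (here ≡.refl) _ → ≤-refl
      (there c′∈) qc′ → ≤-trans x≤c (c≤ c′∈ qc′)
    smaller {c} qx qc c≤ (inj₂ c≤x) = c , qc , λ where
      (here ≡.refl) _ → c≤x
      (there c′∈) qc′ → c≤ c′∈ qc′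

  module _ (δ : Carrier) (0≤δ : 0# ≤ δ) where

    stream : ∀ {d} n → (Fin n → Point d) → Stream d
    stream n f = record
      { len = just n
      ; point = f
      ; arr = λ i → fromℕ (toℕ i) * δ
      ; arr-mono = λ i j i<j → *-monoˡ-≤ 0≤δ (fromℕ-mono-≤ (ℕ.<⇒≤ i<j))
      ; locallyFinite = λ t → n , λ i _ → Fin.toℕ<n i
      }

    module _ {d n : ℕ} (f : Fin n → Point d) (W : Time) (k z : ℕ) (t : Time) where

      -- The radius of a smallest enclosing L∞-ball is half a difference of coordinates.
      candidates : List Carrier
      candidates = map (λ (i , i′ , a) → half (f i a - f i′ a))
        (cartesianProduct (allFin n) (cartesianProduct (allFin n) (allFin d)))

      -- Points in one ball of radius r differ by at most 2r in each coordinate, so half of each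
      -- difference is a candidate not above r, and thus at most c. As L∞-balls are boxes, the ball
      -- can be recentred in each coordinate separately.
      Covers-shrink : ∀ {r c} → 0# ≤ c → (∀ {c′} → c′ ∈ candidates → c′ ≤ r → c′ ≤ c) →
        Covers W k z (stream n f) t r → Covers W k z (stream n f) t c
      Covers-shrink {r} {c} 0≤c rounds (centers , outliers , few , covered) =
        centers′ , outliers , few , λ i active → Sum.map (λ o → o) (λ (j , h) → j , within i j h) (covered i active)
        where
        cluster : Fin k → List (Fin n)
        cluster j = filter (λ i → L∞ (f i) (centers j) ≤? r) (allFin n)

        close : ∀ j a {i i′} → i ∈ cluster j → i′ ∈ cluster j → f i a ≤ f i′ a + (c + c)
        close j a {i} {i′} i∈ i′∈ = ≤-resp refl (+-comm _ _) (x-z≤y⇒x≤y+z (half-≤⁻¹ (rounds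
            (∈-map⁺ _ (∈-cartesianProduct⁺ (∈-allFin i) (∈-cartesianProduct⁺ (∈-allFin i′) (∈-allFin a))))
            (half-≤ (x≤y+z⇒x-z≤y (≤-resp refl (+-comm _ _)
              (same-ball (f i) (f i′) (centers j) (ball i∈) (ball i′∈) a)))))))
          where
          ball : ∀ {i} → i ∈ cluster j → L∞ (f i) (centers j) ≤ r
          ball i∈ = proj₂ (∈-filter⁻ (λ i → L∞ (f i) (centers j) ≤? r) {xs = allFin n} i∈)

        mid : ∀ j a → ∃[ x ] (∀ {i} → i ∈ cluster j → f i a ≤ x + c × x ≤ f i a + c)
        mid j a = midpoint (λ i → f i a) (cluster j) c (close j a)

        centers′ : Fin k → Point d
        centers′ j a = proj₁ (mid j a)

        within : ∀ i j → L∞ (f i) (centers j) ≤ r → L∞ (f i) (centers′ j) ≤ c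
        within i j h = L∞-lub (f i) (centers′ j) 0≤c
          (λ a → proj₁ (proj₂ (mid j a) i∈)) (λ a → proj₂ (proj₂ (mid j a) i∈))
          where
          i∈ : i ∈ cluster j
          i∈ = ∈-filter⁺ (λ i → L∞ (f i) (centers j) ≤? r) (∈-allFin i) h

      -- `Solves` promises something only for an optimal radius, so one must be produced first.
      -- Every feasible radius shrinks to a feasible member of a finite list, hence the least
      -- feasible member is optimal.
      ¬¬-opt : ∀ {r} → 0# ≤ r → Covers W k z (stream n f) t r →
        ¬ ¬ (∃[ opt ] IsOpt W k z (stream n f) t opt)
      ¬¬-opt 0≤r cov h = ¬¬-least Q (0# ∷ candidates) λ where
          (inj₁ (c , (0≤c , covers) , c≤)) → h (c , record
            { nonneg = 0≤c ; covers = covers ; minimal = λ r′ 0≤r′ cov′ →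
                let c′ , c′∈ , q , c′≤r′ = shrunk 0≤r′ cov′ in ≤-trans (c≤ c′∈ q) c′≤r′ })
          (inj₂ none) → let c , c∈ , q , _ = shrunk 0≤r cov in none c∈ q
        where
        Q : Carrier → Set
        Q c = 0# ≤ c × Covers W k z (stream n f) t c
        shrunk : ∀ {r} → 0# ≤ r → Covers W k z (stream n f) t r →
          ∃[ c ] c ∈ 0# ∷ candidates × Q c × c ≤ r
        shrunk 0≤r cov with round-down candidates 0≤r
        ... | c , c∈ , 0≤c , c≤r , rounds = c , c∈ , (0≤c , Covers-shrink 0≤c rounds cov) , c≤r

module Adversary (ℝ : RealField) where

  open FiniteStreams ℝ public

  module _ {d : ℕ} (W : Time) (0<W : 0# < W) (δ : Carrier) (0<δ : 0# < δ)
           (A : Algorithm d) (adheres : Adheres W A) where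

    open Algorithm A
    open Adheres adheres

    private
      0≤δ : 0# ≤ δ
      0≤δ = <⇒≤ 0<δ

      Str : ∀ n → (Fin n → Point d) → Stream d
      Str n f = stream δ 0≤δ n f

    at : ℕ → Time
    at u = fromℕ u * δ

    at-mono : ∀ {u v} → u ℕ.≤ v → at u ≤ at v
    at-mono u≤v = *-monoˡ-≤ 0≤δ (fromℕ-mono-≤ u≤v)

    at-cancel : ∀ {u v} → at u ≤ at v → u ℕ.≤ v
    at-cancel = fromℕ-cancel-≤ ∘ *-cancelʳ-≤ 0<δ

    at-mono-< : ∀ {u v} → u ℕ.< v → at u < at v
    at-mono-< u<v = ≰⇒> (λ h → ℕ.<⇒≱ u<v (at-cancel h))

    0≤at : ∀ u → 0# ≤ at u
    0≤at u = *-nonneg (fromℕ-nonneg u) 0≤δ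

    -- Both the expiration time of the point of rank u and an instant of observation, at which that
    -- point is already gone.
    expires : ℕ → Time
    expires u = at u + W

    expires-cancel : ∀ {u v} → expires u ≤ expires v → u ℕ.≤ v
    expires-cancel = at-cancel ∘ +-cancelʳ-≤ W

    expires-mono-< : ∀ {u v} → u ℕ.< v → expires u < expires v
    expires-mono-< u<v = ≰⇒> (λ h → ℕ.<⇒≱ u<v (expires-cancel h))

    expires-injective : ∀ {u v} → expires u ≈ expires v → u ≡ v
    expires-injective h = ℕ.≤-antisym (expires-cancel (≤-reflexive h)) (expires-cancel (≤-reflexive (sym h)))

    W≤expires : ∀ u → W ≤ expires u
    W≤expires u = ≤-resp (+-identityˡ W) refl (+-monoˡ-≤ W (0≤at u))

    module _ {n : ℕ} (f : Fin n → Point d) (early : at n ≤ W) where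

      arrived : ∀ (i : Fin n) → at (toℕ i) ≤ W
      arrived i = ≤-trans (at-mono (ℕ.<⇒≤ (Fin.toℕ<n i))) early

      active⁺ : ∀ {u} i → u ℕ.< toℕ i → Active W (Str n f) (expires u) i
      active⁺ {u} i u<i = ≤-trans (arrived i) (W≤expires u) , expires-mono-< u<i

      active⁻ : ∀ {u} i → Active W (Str n f) (expires u) i → u ℕ.< toℕ i
      active⁻ i (_ , t<) = ℕ.≰⇒> (λ i≤u → <⇒≱ t< (+-monoˡ-≤ W (at-mono i≤u)))

    module _ {n₀ : ℕ} (f : Fin (suc n₀) → Point d) where

      private
        n = suc n₀
        P₀ = Str n f
        t* = at n₀

      module _ {m : ℕ} (g : Fin m → Point d) where

        private P₁ = Str (n ℕ.+ m) (f ++ g)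

        extends : SameUpTo t* P₀ P₁
        extends q x τ τ≤t* = mk⇔
          (λ (i , rank≡ , pt , time) → i ↑ˡ m , ≡.trans (Fin.toℕ-↑ˡ i m) rank≡ ,
             (λ a → trans (reflexive (≡.cong (λ p → p a) (lookup-++ˡ f g i))) (pt a)) ,
             trans (reflexive (≡.cong at (Fin.toℕ-↑ˡ i m))) time)
          (λ (i , rank≡ , pt , time) →
             let i<n : toℕ i ℕ.< n
                 i<n = ℕ.s≤s (at-cancel (≤-trans (≤-reflexive time) τ≤t*))
             in fromℕ< i<n , ≡.trans (Fin.toℕ-fromℕ< i<n) rank≡ ,
             (λ a → trans (reflexive (≡.cong (λ p → p a) (≡.sym (lookup-++-< f g i i<n)))) (pt a)) ,
             trans (reflexive (≡.cong at (Fin.toℕ-fromℕ< i<n))) time)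

        -- Obliviousness carries the absence of the expiration time from the prefix to the extended
        -- stream, and `no-reuse` carries it on to `expires u`. Between the two instants nothing
        -- arrives, and a stored object could expire only together with point i; so laziness keeps
        -- the storage as it is.
        report-stale : at (n ℕ.+ m) ≤ W → ∀ (i : Fin n) {u} → toℕ i ≡ suc u →
          Unused P₀ t* (expires (toℕ i)) →
          report (S P₁ (expires u)) ≈ report (S P₁ (expires (suc u)))
        report-stale early i {u} i≡ unused₀ = sym (report-determined
          (lazy P₁ (expires u) (expires (suc u)) (expires-mono-< (ℕ.n<1+n u)) no-arrival
            (All.zipWith (λ {o} → no-expiry {o}) (expiration P₁ (expires u) , unused-at-u))))
          where
          i₁ = i ↑ˡ m
          i₁≡ : toℕ i₁ ≡ toℕ i
          i₁≡ = Fin.toℕ-↑ˡ i m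
          t*<W : t* < W
          t*<W = <-≤-trans (at-mono-< (ℕ.s≤s (ℕ.m≤m+n n₀ m))) early
          active : Active W P₁ t* i₁
          active = at-mono (ℕ.≤-trans (ℕ.≤-reflexive i₁≡) (ℕ.s≤s⁻¹ (Fin.toℕ<n i)))
                 , <-≤-trans t*<W (W≤expires (toℕ i₁))
          unused₁ : Unused P₁ t* (expires (toℕ i₁))
          unused₁ = ≡.subst (λ v → Unused P₁ t* (expires v)) (≡.sym i₁≡)
            (Permutation.All-resp-↭ (×-setoid object setoid)
              (λ x≈y x≉e y≈e → x≉e (trans (proj₂ x≈y) y≈e))
              (oblivious P₀ P₁ t* extends) unused₀)
          unused-at-u : Unused P₁ (expires u) (expires (toℕ i₁))
          unused-at-u = no-reuse P₁ t* i₁ active unused₁ (expires u) (<-≤-trans t*<W (W≤expires u))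
          no-arrival : ∀ j → ¬ (expires u < at (toℕ j) × at (toℕ j) ≤ expires (suc u))
          no-arrival j (h , _) = <⇒≱ h (≤-trans (arrived (f ++ g) early j) (W≤expires u))
          no-expiry : ∀ {o : Stored} →
            (∃[ j ] Active W P₁ (expires u) j × proj₂ o ≈ exp W P₁ j) × ¬ proj₂ o ≈ expires (toℕ i₁) →
            ¬ (expires u < proj₂ o × proj₂ o ≤ expires (suc u))
          no-expiry {o} ((j , j-active , o≈) , o≉) (_ , o≤) =
            o≉ (trans o≈ (reflexive (≡.cong expires j≡i₁)))
            where
            j≡i₁ : toℕ j ≡ toℕ i₁
            j≡i₁ = ≡.trans (ℕ.≤-antisym (expires-cancel (≤-trans (≤-reflexive (sym o≈)) o≤))
                     (active⁻ (f ++ g) early j j-active)) (≡.sym (≡.trans i₁≡ i≡))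

        forced : at (n ℕ.+ m) ≤ W → ∀ {k z ε σ} → Fin k → 0# ≤ 1# - ε → 0# ≤ 1# + ε → Solves σ A W k z ε → HasSpread P₁ σ →
          ∀ (i : Fin n) {u} → toℕ i ≡ suc u → ∀ {D E} → 0# ≤ E →
          (∀ r → Covers W k z P₁ (expires u) r → D ≤ r + r) →
          Covers W k z P₁ (expires (suc u)) (half E) →
          ¬ (1# - ε) * D ≤ (1# + ε) * E →
          ¬ Unused P₀ t* (expires (toℕ i))
        forced early {k} {z} {ε} c₀ 0≤1-ε 0≤1+ε solves spread i {u} i≡ {D} {E} 0≤E lower upper gap unused =
          ¬¬-opt δ 0≤δ (f ++ g) W k z (expires u) 0≤largest trivial-cover λ (r , r-opt) →
          ¬¬-opt δ 0≤δ (f ++ g) W k z (expires (suc u)) (half-nonneg 0≤E) upper λ (r′ , r′-opt) →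
          gap (drop r r′ (proj₂ (solves P₁ spread (expires (suc u)) r′ r′-opt))
                (proj₁ (solves P₁ spread (expires u) r r-opt))
                (lower r (IsOpt.covers r-opt)) (IsOpt.minimal r′-opt (half E) (half-nonneg 0≤E) upper))
          where
          open HasSpread spread
          0≤largest : 0# ≤ largest
          0≤largest = let a , b , a≢b , _ = smallest-attained in
            ≤-trans (<⇒≤ smallest-positive) (≤-trans (smallest-≤ a b a≢b) (≤-largest a b a≢b))
          i₁ = i ↑ˡ m
          near : ∀ j → L∞ ((f ++ g) j) ((f ++ g) i₁) ≤ largest
          near j with j Fin.≟ i₁
          ... | no j≢i₁ = ≤-largest j i₁ j≢i₁
          ... | yes ≡.refl = L∞-lub ((f ++ g) i₁) ((f ++ g) i₁) 0≤largest (λ a → x≤x+y _ 0≤largest) (λ a → x≤x+y _ 0≤largest)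
          -- Any cover will do to obtain an optimum; as k ≥ 1, one ball around point i is available.
          trivial-cover : Covers W k z P₁ (expires u) largest
          trivial-cover = (λ _ → (f ++ g) i₁) , [] , ℕ.z≤n , λ j _ → inj₂ (c₀ , near j)
          stale = report-stale early i i≡ unused
          drop : ∀ r r′ → report (S P₁ (expires (suc u))) ≤ (1# + ε) * r′ →
            (1# - ε) * r ≤ report (S P₁ (expires u)) → D ≤ r + r → r′ ≤ half E →
            (1# - ε) * D ≤ (1# + ε) * E
          drop r r′ ≤r′ r≤ D≤2r r′≤ = begin
            (1# - ε) * D                      ≤⟨ *-monoʳ-≤ 0≤1-ε D≤2r ⟩
            (1# - ε) * (r + r)                ≈⟨ distribˡ _ r r ⟩
            (1# - ε) * r + (1# - ε) * r       ≤⟨ +-mono-≤ r≤h r≤h ⟩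
            (1# + ε) * half E + (1# + ε) * half E ≈⟨ distribˡ _ _ _ ⟨
            (1# + ε) * (half E + half E)      ≈⟨ *-congˡ (half+half E) ⟩
            (1# + ε) * E                      ∎
            where
            r≤h : (1# - ε) * r ≤ (1# + ε) * half E
            r≤h = ≤-trans r≤ (≤-trans (≤-reflexive stale) (≤-trans ≤r′ (*-monoʳ-≤ 0≤1+ε r′≤)))

      every-expiration-used : ∀ N (i : Fin N → Fin n) → (∀ {a b} → toℕ (i a) ≡ toℕ (i b) → a ≡ b) →
        (∀ a → ¬ Unused P₀ t* (expires (toℕ (i a)))) → N ℕ.≤ length (S P₀ t*)
      every-expiration-used N i i-injective used = Fin.injective⇒≤ {f = Any.index ∘ user} injective
        where
        user : ∀ a → Any (λ o → proj₂ o ≈ expires (toℕ (i a))) (S P₀ t*)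
        user a = Any.map (λ {o} ¬¬o → decidable-stable (proj₂ o ≟ expires (toℕ (i a))) ¬¬o)
          (¬All⇒Any¬ (λ o → ¬? (proj₂ o ≟ expires (toℕ (i a)))) (S P₀ t*) (used a))
        injective : ∀ {a b} → Any.index (user a) ≡ Any.index (user b) → a ≡ b
        injective {a} {b} eq = i-injective (expires-injective
          (trans (sym (lookup-index (user a))) (trans (reflexive (≡.cong (λ j → proj₂ (lookup (S P₀ t*) j)) eq)) (lookup-index (user b)))))

-- Streams of lattice points: their spread, and bounds on their covering radius.

Separated : ∀ {d} → ℕ → (p q : Fin d → ℕ) → Set
Separated D p q = ∃[ a ] (p a ℕ.+ D ℕ.≤ q a ⊎ q a ℕ.+ D ℕ.≤ p a)

InBox : ∀ {d} → (lo : Fin d → ℕ) → ℕ → (Fin d → ℕ) → Set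
InBox lo E p = ∀ a → lo a ℕ.≤ p a × p a ℕ.≤ lo a ℕ.+ E

-- Otherwise the positions in the list would inject z + 1 indices into at most z places.
escapes : ∀ {n z} (xs : List (Fin n)) → length xs ℕ.≤ z → (F : Fin (suc z) → Fin n) →
  (∀ {s t} → F s ≡ F t → s ≡ t) → ∃[ s ] F s ∉ xs
escapes {n} {z} xs few F F-injective = Fin.¬∀⟶∃¬ (suc z) (λ s → F s ∈ xs) (λ s → F s ∈? xs) λ all∈ →
  ℕ.<⇒≱ (Fin.injective⇒≤ {f = λ s → Any.index (all∈ s)} (λ {s} {t} eq → F-injective
    (≡.trans (lookup-index (all∈ s)) (≡.trans (≡.cong (lookup xs) eq) (≡.sym (lookup-index (all∈ t))))))) few
  where open DecMembership (Fin._≟_ {n}) using (_∈?_)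

module LatticeStreams (ℝ : RealField) where

  open Adversary ℝ public

  embed : ∀ {d} → (Fin d → ℕ) → Point d
  embed p a = fromℕ (p a)

  embed-≤ : ∀ {x y r} → x ℕ.≤ y ℕ.+ r → fromℕ x ≤ fromℕ y + fromℕ r
  embed-≤ {x} {y} {r} h = ≤-resp refl (fromℕ-+ y r) (fromℕ-mono-≤ h)

  separated⇒≤ : ∀ {d D r} (p q : Fin d → ℕ) → Separated D p q →
    (∀ a → embed p a ≤ embed q a + r) → (∀ a → embed q a ≤ embed p a + r) → fromℕ D ≤ r
  separated⇒≤ p q (a , inj₁ h) _ q≤p = +-cancelˡ-≤ _ (≤-trans (≤-resp (fromℕ-+ (p a) _) refl (fromℕ-mono-≤ h)) (q≤p a))
  separated⇒≤ p q (a , inj₂ h) p≤q _ = +-cancelˡ-≤ _ (≤-trans (≤-resp (fromℕ-+ (q a) _) refl (fromℕ-mono-≤ h)) (p≤q a))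

  separated-L∞ : ∀ {d D} (p q : Fin d → ℕ) → Separated D p q → fromℕ D ≤ L∞ (embed p) (embed q)
  separated-L∞ p q sep = separated⇒≤ p q sep (L∞⇒≤ (embed p) (embed q) ≤-refl) (L∞⇒≥ (embed p) (embed q) ≤-refl)

  L∞-sym-≤ : ∀ {d} (p q : Point d) {r} → L∞ p q ≤ r → L∞ q p ≤ r
  L∞-sym-≤ p q h = L∞-lub q p (≤-trans (foldr-⊔-nonneg (λ a → ∣ p a - q a ∣)) h) (L∞⇒≥ p q h) (L∞⇒≤ p q h)

  ≤-L∞-sym : ∀ {d} (p q : Point d) {r} → r ≤ L∞ p q → r ≤ L∞ q p
  ≤-L∞-sym p q h = ≤-trans h (L∞-sym-≤ q p ≤-refl)

  module _ (δ : Carrier) (0≤δ : 0# ≤ δ) {d n : ℕ} (h : Fin (3 ℕ.+ n) → Point (suc d))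
           (f : Fin n → Fin (suc d) → ℕ) (h-lattice : ∀ i → h (3 ↑ʳ i) ≡ embed (f i)) where

    P : Stream (suc d)
    P = stream δ 0≤δ (3 ℕ.+ n) h

    -- The first three points only serve to make the spread equal to σ.
    module _ (σ : Carrier) (h₀ : h zero ≡ const 0#) (h₁ : h (suc zero) ≡ const 1#)
             (h₂ : h (suc (suc zero)) ≡ const σ)
             (f-injective : ∀ {i j} → i ≢ j → Separated 1 (f i) (f j))
             (2≤f : ∀ i a → 2 ℕ.≤ f i a) (f≤σ : ∀ i a → fromℕ (suc (f i a)) ≤ σ) (2≤σ : fromℕ 2 ≤ σ) where

      private
        1≤σ : 1# ≤ σ
        1≤σ = ≤-trans (≤-resp fromℕ-1 refl (fromℕ-mono-≤ (ℕ.n≤1+n 1))) 2≤σ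

        0≤σ : 0# ≤ σ
        0≤σ = ≤-trans 0≤1 1≤σ

        InRange : Point (suc d) → Set
        InRange p = ∀ a → 0# ≤ p a × p a ≤ σ

        in-range : ∀ i → InRange (h i)
        in-range zero rewrite h₀ = λ a → ≤-refl , 0≤σ
        in-range (suc zero) rewrite h₁ = λ a → 0≤1 , 1≤σ
        in-range (suc (suc zero)) rewrite h₂ = λ a → 0≤σ , ≤-refl
        in-range (suc (suc (suc i))) rewrite h-lattice i = λ a →
          fromℕ-nonneg (f i a) , ≤-trans (fromℕ-mono-≤ (ℕ.n≤1+n (f i a))) (f≤σ i a)

        largest≤ : ∀ {p q : Point (suc d)} → InRange p → InRange q → L∞ p q ≤ σ
        largest≤ {p} {q} hp hq = L∞-lub p q 0≤σ (λ a → le (proj₂ (hp a)) (proj₁ (hq a))) (λ a → le (proj₂ (hq a)) (proj₁ (hp a)))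
          where
          le : ∀ {x y} → x ≤ σ → 0# ≤ y → x ≤ y + σ
          le x≤σ 0≤y = ≤-resp refl (+-comm σ _) (≤-trans x≤σ (x≤x+y σ 0≤y))

        apart : ∀ {p q : Point (suc d)} {r} → p zero + r ≤ q zero → r ≤ L∞ p q
        apart {p} {q} h = +-cancelˡ-≤ (p zero) (≤-trans h (L∞⇒≥ p q ≤-refl zero))

        1+1≤σ : 1# + 1# ≤ σ
        1+1≤σ = ≤-trans (≤-reflexive (+-congˡ (sym (+-identityʳ 1#)))) 2≤σ

        1≤0th : ∀ (q : Point (suc d)) → 1# ≤ q zero → 1# ≤ L∞ (const 0#) q
        1≤0th q 1≤q = apart {const 0#} {q} (≤-resp (sym (+-identityˡ 1#)) refl 1≤q)

        1≤1st : ∀ (q : Point (suc d)) → 1# + 1# ≤ q zero → 1# ≤ L∞ (const 1#) q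
        1≤1st q = apart {const 1#} {q}

        2≤h : ∀ i → 1# + 1# ≤ h (suc (suc i)) zero
        2≤h zero rewrite h₂ = 1+1≤σ
        2≤h (suc i) rewrite h-lattice i = ≤-trans (≤-reflexive (+-congˡ (sym (+-identityʳ 1#)))) (fromℕ-mono-≤ (2≤f i zero))

        1≤h : ∀ i → 1# ≤ h (suc i) zero
        1≤h zero rewrite h₁ = ≤-refl
        1≤h (suc i) = ≤-trans (x≤x+y 1# 0≤1) (2≤h i)

        below-σ : ∀ i → 1# ≤ L∞ (h (3 ↑ʳ i)) (const σ)
        below-σ i rewrite h-lattice i = apart {embed (f i)} {const σ} (≤-trans (≤-reflexive (+-comm _ 1#)) (f≤σ i zero))

        smallest≤ : ∀ i j → i ≢ j → 1# ≤ L∞ (h i) (h j)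
        smallest≤ zero zero i≢j = contradiction ≡.refl i≢j
        smallest≤ zero (suc j) i≢j rewrite h₀ = 1≤0th (h (suc j)) (1≤h j)
        smallest≤ (suc i) zero i≢j rewrite h₀ = ≤-L∞-sym (const 0#) (h (suc i)) (1≤0th (h (suc i)) (1≤h i))
        smallest≤ (suc zero) (suc zero) i≢j = contradiction ≡.refl i≢j
        smallest≤ (suc zero) (suc (suc j)) i≢j rewrite h₁ = 1≤1st (h (suc (suc j))) (2≤h j)
        smallest≤ (suc (suc i)) (suc zero) i≢j rewrite h₁ = ≤-L∞-sym (const 1#) (h (suc (suc i))) (1≤1st (h (suc (suc i))) (2≤h i))
        smallest≤ (suc (suc zero)) (suc (suc zero)) i≢j = contradiction ≡.refl i≢j
        smallest≤ (suc (suc zero)) (suc (suc (suc j))) i≢j rewrite h₂ = ≤-L∞-sym (h (3 ↑ʳ j)) (const σ) (below-σ j)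
        smallest≤ (suc (suc (suc i))) (suc (suc zero)) i≢j rewrite h₂ = below-σ i
        smallest≤ (suc (suc (suc i))) (suc (suc (suc j))) i≢j rewrite h-lattice i | h-lattice j =
          ≤-resp fromℕ-1 refl (separated-L∞ (f i) (f j) (f-injective (i≢j ∘ ≡.cong (3 ↑ʳ_))))

      -- The points 0 and 1 realise the distance 1, and 0 and σ the distance σ. Lattice coordinates
      -- between 2 and σ - 1 keep every other point at distance at least 1 from all three.
      has-spread : HasSpread P σ
      has-spread = record
        { smallest = 1#
        ; largest = σ
        ; smallest-positive = 0<1
        ; smallest-attained = zero , suc zero , (λ ()) , antisym attained (smallest≤ zero (suc zero) (λ ()))
        ; largest-attained = zero , suc (suc zero) , (λ ()) , antisym (largest≤ (in-range zero) (in-range (suc (suc zero)))) attained′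
        ; smallest-≤ = smallest≤
        ; ≤-largest = λ i j _ → largest≤ (in-range i) (in-range j)
        ; ratio = trans (sym (x/z*z≈x 0<1)) (*-identityʳ _)
        }
        where
        attained : L∞ (h zero) (h (suc zero)) ≤ 1#
        attained rewrite h₀ | h₁ = L∞-lub {suc d} (const 0#) (const 1#) 0≤1
          (λ _ → ≤-trans 0≤1 (x≤x+y 1# 0≤1)) (λ _ → ≤-reflexive (sym (+-identityˡ 1#)))
        attained′ : σ ≤ L∞ (h zero) (h (suc (suc zero)))
        attained′ rewrite h₀ | h₂ = apart {const 0#} {const σ} (≤-reflexive (+-identityˡ σ))

    module _ (W : Time) {k z : ℕ} {t : Time} where

      -- In each of the k + 1 groups some point is not an outlier, and two of these survivors share
      -- one of the k balls.
      lower-bound : ∀ {D} (G : Fin (suc k) → Fin (suc z) → Fin n) →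
        (∀ g {s s′} → G g s ≡ G g s′ → s ≡ s′) →
        (∀ g s → Active W P t (3 ↑ʳ G g s)) →
        (∀ {g g′} → g ≢ g′ → ∀ s s′ → Separated D (f (G g s)) (f (G g′ s′))) →
        ∀ r → Covers W k z P t r → fromℕ D ≤ r + r
      lower-bound {D} G G-injective active far r (centers , outliers , few , covered) =
        separated⇒≤ (f p) (f q) apart
          (same-ball (embed (f p)) (embed (f q)) (centers (center g′)) (near g same) (near g′ ≡.refl))
          (same-ball (embed (f q)) (embed (f p)) (centers (center g′)) (near g′ ≡.refl) (near g same))
        where
        survivor : Fin (suc k) → Fin (suc z)
        survives : ∀ g → 3 ↑ʳ G g (survivor g) ∉ outliers
        escape : ∀ g → ∃[ s ] 3 ↑ʳ G g s ∉ outliers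
        escape g = escapes outliers few (λ s → 3 ↑ʳ G g s) (G-injective g ∘ Fin.↑ʳ-injective 3 _ _)
        survivor g = proj₁ (escape g)
        survives g = proj₂ (escape g)
        choice : ∀ g → ∃[ j ] L∞ (embed (f (G g (survivor g)))) (centers j) ≤ r
        choice g with covered (3 ↑ʳ G g (survivor g)) (active g (survivor g))
        ... | inj₁ out = contradiction out (survives g)
        ... | inj₂ (j , close) = j , ≡.subst (λ p → L∞ p (centers j) ≤ r) (h-lattice (G g (survivor g))) close
        center : Fin (suc k) → Fin k
        center g = proj₁ (choice g)
        near : ∀ g {j} → center g ≡ j → L∞ (embed (f (G g (survivor g)))) (centers j) ≤ r
        near g ≡.refl = proj₂ (choice g)
        collision = Fin.pigeonhole (ℕ.n<1+n k) center
        g = proj₁ collision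
        g′ = proj₁ (proj₂ collision)
        g<g′ = proj₁ (proj₂ (proj₂ collision))
        p = G g (survivor g)
        q = G g′ (survivor g′)
        same = proj₂ (proj₂ (proj₂ collision))
        apart : Separated D (f p) (f q)
        apart = far (Fin.<⇒≢ g<g′) (survivor g) (survivor g′)

      -- An L∞-ball of radius E/2 is a box of side E, here given by its lower corner. No box is set
      -- aside for the three auxiliary points, so they must have expired.
      upper-bound : ∀ {E} (lo : Fin k → Fin (suc d) → ℕ) (out : Fin z → Fin n) →
        (∀ (i : Fin 3) → ¬ Active W P t (i ↑ˡ n)) →
        (∀ i → Active W P t (3 ↑ʳ i) → (∃[ u ] i ≡ out u) ⊎ (∃[ j ] InBox (lo j) E (f i))) →
        Covers W k z P t (half (fromℕ E))
      upper-bound {E} lo out inactive boxed =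
          (λ j a → fromℕ (lo j a) + half (fromℕ E))
        , tabulate (λ u → 3 ↑ʳ out u)
        , ℕ.≤-reflexive (length-tabulate _)
        , covered
        where
        0≤E/2 : 0# ≤ half (fromℕ E)
        0≤E/2 = half-nonneg (fromℕ-nonneg E)
        covered : ∀ i → Active W P t i → i ∈ tabulate (λ u → 3 ↑ʳ out u) ⊎
          (∃[ j ] L∞ (h i) (λ a → fromℕ (lo j a) + half (fromℕ E)) ≤ half (fromℕ E))
        covered zero act = contradiction act (inactive zero)
        covered (suc zero) act = contradiction act (inactive (suc zero))
        covered (suc (suc zero)) act = contradiction act (inactive (suc (suc zero)))
        covered (suc (suc (suc i))) act with boxed i act
        ... | inj₁ (u , ≡.refl) = inj₁ (∈-tabulate⁺ u)
        ... | inj₂ (j , box) rewrite h-lattice i = inj₂ (j , L∞-lub (embed (f i)) _ 0≤E/2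
          (λ a → ≤-resp refl (sym (trans (+-assoc _ _ _) (+-congˡ (half+half _)))) (embed-≤ {f i a} {lo j a} (proj₂ (box a))))
          (λ a → +-monoˡ-≤ _ (fromℕ-mono-≤ (proj₁ (box a)))))

-- The construction in natural numbers: scales, towers, segments.

module Lattice where

  open import Data.Nat using (_+_; _*_; _^_; _∸_; _≤_; _<_; z≤n; s≤s)
  open import Relation.Binary.PropositionalEquality using (refl; sym; trans; cong; cong₂; subst; subst₂)

  ≤-by : ∀ {m n} k → m + k ≡ n → m ≤ n
  ≤-by k refl = ℕ.m≤m+n _ k

  <⇒∃ : ∀ {m n} → m < n → ∃[ k ] suc m + k ≡ n
  <⇒∃ h = ℕ.m≤n⇒∃[o]m+o≡n h

  Separated-sym : ∀ {d D} {p q : Fin d → ℕ} → Separated D p q → Separated D q p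
  Separated-sym (a , h) = a , Sum.swap h

  Separated⇒¬≗ : ∀ {d D} {p q : Fin d → ℕ} → 0 < D → Separated D p q → ¬ p ≗ q
  Separated⇒¬≗ 0<D (a , inj₁ h) p≗q = ℕ.<⇒≢ (ℕ.<-≤-trans (ℕ.m<m+n _ 0<D) h) (p≗q a)
  Separated⇒¬≗ 0<D (a , inj₂ h) p≗q = ℕ.<⇒≢ (ℕ.<-≤-trans (ℕ.m<m+n _ 0<D) h) (sym (p≗q a))

  ¬≗⇒Separated : ∀ {d} {p q : Fin d → ℕ} → ¬ p ≗ q → Separated 1 p q
  ¬≗⇒Separated {d} {p} {q} ¬p≗q with Fin.¬∀⟶∃¬ d (λ a → p a ≡ q a) (λ a → p a ℕ.≟ q a) ¬p≗q
  ... | a , pa≢qa with ℕ.<-cmp (p a) (q a)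
  ... | tri< p<q _ _ = a , inj₁ (subst (_≤ q a) (ℕ.+-comm 1 (p a)) p<q)
  ... | tri≈ _ p≡q _ = contradiction p≡q pa≢qa
  ... | tri> _ _ q<p = a , inj₂ (subst (_≤ p a) (ℕ.+-comm 1 (q a)) q<p)

  finToFun-injective : ∀ {m n} {i j : Fin (n ^ m)} → finToFun {n} {m} i ≗ finToFun j → i ≡ j
  finToFun-injective {zero} {i = zero} {zero} _ = refl
  finToFun-injective {suc m} {n} {i} {j} eq =
    trans (sym (Fin.combine-remQuot {n} (n ^ m) i))
      (trans (cong₂ combine (eq zero) (finToFun-injective {m} {n} (eq ∘ suc)))
        (Fin.combine-remQuot {n} (n ^ m) j))

  module Digits {n : ℕ} (k : ℕ) where

    high : Fin (n * k) → Fin n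
    high i = proj₁ (remQuot {n} k i)

    low : Fin (n * k) → Fin k
    low i = proj₂ (remQuot {n} k i)

    combine-high-low : ∀ i → combine (high i) (low i) ≡ i
    combine-high-low = Fin.combine-remQuot {n} k

    high-low-injective : ∀ {i j} → high i ≡ high j → low i ≡ low j → i ≡ j
    high-low-injective {i} {j} eq eq′ =
      trans (sym (combine-high-low i)) (trans (cong₂ combine eq eq′) (combine-high-low j))

    high-mono-≤ : ∀ {i j} → toℕ i ≤ toℕ j → toℕ (high i) ≤ toℕ (high j)
    high-mono-≤ {i} {j} i≤j = ℕ.≮⇒≥ λ j<i → ℕ.<⇒≱
      (subst₂ _<_ (cong toℕ (combine-high-low j)) (cong toℕ (combine-high-low i))
        (Fin.combine-monoˡ-< (low j) (low i) j<i)) i≤j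

    low-mono-< : ∀ {i j} → high i ≡ high j → toℕ i < toℕ j → toℕ (low i) < toℕ (low j)
    low-mono-< {i} {j} eq i<j = ℕ.+-cancelˡ-< (k * toℕ (high i)) _ _
      (subst₂ _<_ (expand i) (trans (expand j) (cong (λ h → k * toℕ h + toℕ (low j)) (sym eq))) i<j)
      where
      expand : ∀ i → toℕ i ≡ k * toℕ (high i) + toℕ (low i)
      expand i = trans (cong toℕ (sym (combine-high-low i))) (Fin.toℕ-combine (high i) (low i))

  module Scale (ℓ : ℕ) where

    -- For ι < ℓ this runs in steps of 4n from 4n(ℓ + 1) to 8nℓ. The summand `suc ℓ` lifts the grid
    -- one step above every grid of at most half its scale.
    offset : ℕ → ℕ → ℕ
    offset ι n = n * 4 * (suc ℓ + ι)

    -- `reach` is R, and `diam` is what remains of it after the loss of one unit to the segments.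
    -- `side`, the side of the covering boxes, is 2n less than `diam`, half a grid step; it must
    -- exceed both the width 8nℓ of a tower and `reach` minus one step.
    diam side reach : ℕ → ℕ
    diam n = ℓ * n * 8 + n * 8
    side n = ℓ * n * 8 + n * 6
    reach n = suc (diam n)

    offset-≥ : ∀ ι n → ℓ * n * 4 + n * 4 ≤ offset ι n
    offset-≥ ι n = ≤-by (ι * (n * 4)) (eq ℓ ι n)
      where
      eq : ∀ ℓ ι n → ℓ * n * 4 + n * 4 + ι * (n * 4) ≡ n * 4 * (suc ℓ + ι)
      eq = solve-∀

    offset-≤ : ∀ {ι} n → ι < ℓ → offset ι n ≤ ℓ * n * 8
    offset-≤ {ι} n ι<ℓ = begin
      n * 4 * (suc ℓ + ι) ≡⟨ cong (n * 4 *_) (ℕ.+-suc ℓ ι) ⟨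
      n * 4 * (ℓ + suc ι) ≤⟨ ℕ.*-monoʳ-≤ (n * 4) (ℕ.+-monoʳ-≤ ℓ ι<ℓ) ⟩
      n * 4 * (ℓ + ℓ)     ≡⟨ eq ℓ n ⟩
      ℓ * n * 8           ∎
      where
      open ℕ.≤-Reasoning
      eq : ∀ ℓ n → n * 4 * (ℓ + ℓ) ≡ ℓ * n * 8
      eq = solve-∀

    offset-gap : ∀ {ι ι′} n → ι < ι′ → offset ι n + n * 4 ≤ offset ι′ n
    offset-gap {ι} {ι′} n ι<ι′ = begin
      n * 4 * (suc ℓ + ι) + n * 4 ≡⟨ eq (n * 4) (suc ℓ) ι ⟩
      n * 4 * (suc ℓ + suc ι)     ≤⟨ ℕ.*-monoʳ-≤ (n * 4) (ℕ.+-monoʳ-≤ (suc ℓ) ι<ι′) ⟩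
      n * 4 * (suc ℓ + ι′)        ∎
      where
      open ℕ.≤-Reasoning
      eq : ∀ m x ι → m * (x + ι) + m ≡ m * (x + suc ι)
      eq = solve-∀

    offset-scale-gap : ∀ {ι′} ι {n n′} → ι′ < ℓ → 2 * n′ ≤ n → offset ι′ n′ + n * 4 ≤ offset ι n
    offset-scale-gap {ι′} ι {n} {n′} ι′<ℓ 2n′≤n = begin
      offset ι′ n′ + n * 4       ≤⟨ ℕ.+-monoˡ-≤ (n * 4) (offset-≤ n′ ι′<ℓ) ⟩
      ℓ * n′ * 8 + n * 4       ≡⟨ cong (_+ n * 4) (eq ℓ n′) ⟩
      ℓ * (2 * n′) * 4 + n * 4 ≤⟨ ℕ.+-monoˡ-≤ (n * 4) (ℕ.*-monoˡ-≤ 4 (ℕ.*-monoʳ-≤ ℓ 2n′≤n)) ⟩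
      ℓ * n * 4 + n * 4        ≤⟨ offset-≥ ι n ⟩
      offset ι n                 ∎
      where
      open ℕ.≤-Reasoning
      eq : ∀ ℓ n → ℓ * n * 8 ≡ ℓ * (2 * n) * 4
      eq = solve-∀

    8ℓn≤reach : ∀ n → ℓ * n * 8 ≤ reach n
    8ℓn≤reach n = ℕ.m≤n⇒m≤1+n (ℕ.m≤m+n _ _)

    side>8ℓn : ∀ {n} → 1 ≤ n → ℓ * n * 8 < side n
    side>8ℓn {suc n} _ = ℕ.m<m+n (ℓ * suc n * 8) (s≤s z≤n)

    -- So a displaced node fits into a box of this side with the part of its tower
    -- that lies at least 4 n beyond the centre.
    reach<4n+side : ∀ {n} → 1 ≤ n → reach n < n * 4 + side n
    reach<4n+side {n} 1≤n = begin
      2 + (ℓ * n * 8 + n * 8)     ≤⟨ ℕ.+-monoˡ-≤ (ℓ * n * 8 + n * 8) (ℕ.*-monoˡ-≤ 2 1≤n) ⟩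
      n * 2 + (ℓ * n * 8 + n * 8) ≡⟨ eq (ℓ * n * 8) n ⟩
      n * 4 + (ℓ * n * 8 + n * 6) ∎
      where
      open ℕ.≤-Reasoning
      eq : ∀ x n → n * 2 + (x + n * 8) ≡ n * 4 + (x + n * 6)
      eq = solve-∀

    side-mono : ∀ {n n′} → n ≤ n′ → ℓ * n * 8 ≤ ℓ * n′ * 8
    side-mono n≤n′ = ℕ.*-monoˡ-≤ 8 (ℕ.*-monoʳ-≤ ℓ n≤n′)

    diam-mono : ∀ {n n′} → n ≤ n′ → diam n ≤ diam n′
    diam-mono n≤n′ = ℕ.+-mono-≤ (side-mono n≤n′) (ℕ.*-monoˡ-≤ 8 n≤n′)

  -- There are suc κ towers, each consisting of grids with ℓ ^ suc e points at the
  -- scales 1, 2, …, 2 ^ J.  The origins of the grids are chosen such that in each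
  -- coordinate a finer grid of the same tower lies below the coarser ones.
  module Towers (e ℓ κ J : ℕ) where

    open Scale ℓ public

    private d = suc e

    -- A single number, so that stream order is the order of `Fin`. The level is its most
    -- significant digit, followed by the tower and the position in the grid; hence no later cell,
    -- in whichever tower, has a coarser grid.
    Cell : Set
    Cell = Fin (suc J * (suc κ * ℓ ^ d))

    private
      module Level = Digits {suc J} (suc κ * ℓ ^ d)
      module Tower = Digits {suc κ} (ℓ ^ d)

    level : Cell → Fin (suc J)
    level = Level.high

    tower : Cell → Fin (suc κ)
    tower = Tower.high ∘ Level.low

    grid : Cell → Fin d → Fin ℓ
    grid γ = finToFun {ℓ} {d} (Tower.low (Level.low γ))

    level-mono-≤ : ∀ {γ γ′ : Cell} → toℕ γ ≤ toℕ γ′ → toℕ (level γ) ≤ toℕ (level γ′)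
    level-mono-≤ = Level.high-mono-≤

    Cell-≡ : ∀ {γ γ′ : Cell} → level γ ≡ level γ′ → tower γ ≡ tower γ′ → grid γ ≗ grid γ′ → γ ≡ γ′
    Cell-≡ eq eq′ eq″ = Level.high-low-injective eq (Tower.high-low-injective eq′ (finToFun-injective {d} {ℓ} eq″))

    -- Coarse grids come first in the stream.
    scale : Cell → ℕ
    scale γ = 2 ^ toℕ (opposite (level γ))

    1≤scale : ∀ γ → 1 ≤ scale γ
    1≤scale γ = ℕ.m^n>0 2 (toℕ (opposite (level γ)))

    scale-≤-max : ∀ γ → scale γ ≤ 2 ^ J
    scale-≤-max γ = ℕ.^-monoʳ-≤ 2 (Fin.toℕ≤pred[n] (opposite (level γ)))

    scale-antitone : ∀ {γ γ′ : Cell} → toℕ (level γ) ≤ toℕ (level γ′) → scale γ′ ≤ scale γ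
    scale-antitone {γ} {γ′} h = ℕ.^-monoʳ-≤ 2 (subst₂ _≤_ (sym (Fin.opposite-prop (level γ′))) (sym (Fin.opposite-prop (level γ)))
      (ℕ.∸-monoʳ-≤ (suc J) (s≤s h)))

    scale-antitone-< : ∀ {γ γ′ : Cell} → toℕ (level γ) < toℕ (level γ′) → 2 * scale γ′ ≤ scale γ
    scale-antitone-< {γ} {γ′} h = ℕ.^-monoʳ-≤ 2 (subst₂ _<_ (sym (Fin.opposite-prop (level γ′))) (sym (Fin.opposite-prop (level γ)))
      (ℕ.∸-monoʳ-< (s≤s h) (Fin.toℕ<n (level γ′))))

    off : Cell → Fin d → ℕ
    off γ a = offset (toℕ (grid γ a)) (scale γ)

    off-≤ : ∀ γ a → off γ a ≤ ℓ * scale γ * 8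
    off-≤ γ a = offset-≤ (scale γ) (Fin.toℕ<n (grid γ a))

    -- On one level, distinct cells differ in a grid digit, hence by a step. On a finer level γ′ is
    -- a step lower in every coordinate, so coordinate zero serves.
    off-gap : ∀ {γ γ′} → tower γ ≡ tower γ′ → γ ≢ γ′ → toℕ (level γ) ≤ toℕ (level γ′) →
      ∃[ a ] (off γ′ a + scale γ * 4 ≤ off γ a ⊎ off γ a + scale γ * 4 ≤ off γ′ a)
    off-gap {γ} {γ′} tower≡ γ≢γ′ level≤ with level γ Fin.≟ level γ′
    ... | no level≢ = zero , inj₁ (offset-scale-gap (toℕ (grid γ zero)) {scale γ} {scale γ′} (Fin.toℕ<n (grid γ′ zero))
            (scale-antitone-< {γ} {γ′} (ℕ.≤∧≢⇒< level≤ (level≢ ∘ Fin.toℕ-injective))))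
    ... | yes level≡ with Fin.¬∀⟶∃¬ d (λ a → grid γ a ≡ grid γ′ a) (λ a → grid γ a Fin.≟ grid γ′ a)
                            (γ≢γ′ ∘ Cell-≡ level≡ tower≡)
    ... | a , grid≢ with scale γ | scale γ′ | cong (λ j → 2 ^ toℕ (opposite j)) level≡ | ℕ.<-cmp (toℕ (grid γ a)) (toℕ (grid γ′ a))
    ... | n | .n | refl | tri< lt _ _ = a , inj₂ (offset-gap n lt)
    ... | n | .n | refl | tri≈ _ eq _ = contradiction (Fin.toℕ-injective eq) grid≢
    ... | n | .n | refl | tri> _ _ gt = a , inj₁ (offset-gap n gt)

    -- Larger than any `reach` and than the width of any tower. A tower with its displaced nodes
    -- thus fits into three times this length, the spacing of the anchors; and as anchors start at
    -- `origin`, subtracting `reach` never truncates.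
    origin : ℕ
    origin = suc (suc (diam (2 ^ J)))

    anchor : Fin (suc κ) → ℕ
    anchor c = origin + toℕ c * (origin * 3)

    base : Cell → Fin d → ℕ
    base γ a = anchor (tower γ) + off γ a

    reach<origin : ∀ γ → reach (scale γ) < origin
    reach<origin γ = s≤s (s≤s (diam-mono (scale-≤-max γ)))

    off≤reach : ∀ γ a → off γ a ≤ reach (scale γ)
    off≤reach γ a = ℕ.≤-trans (off-≤ γ a) (8ℓn≤reach (scale γ))

    off<origin : ∀ γ a → off γ a < origin
    off<origin γ a = ℕ.≤-<-trans (off≤reach γ a) (reach<origin γ)

    origin≤anchor : ∀ c → origin ≤ anchor c
    origin≤anchor c = ℕ.m≤m+n _ _

    reach<base : ∀ γ a → reach (scale γ) < base γ a
    reach<base γ a = ℕ.<-≤-trans (reach<origin γ) (ℕ.≤-trans (origin≤anchor (tower γ)) (ℕ.m≤m+n _ _))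

    anchor-gap : ∀ {c c′ : Fin (suc κ)} → toℕ c < toℕ c′ → anchor c + origin * 3 ≤ anchor c′
    anchor-gap {c} {c′} c<c′ = begin
      origin + toℕ c * (origin * 3) + origin * 3 ≡⟨ eq origin (toℕ c) ⟩
      origin + suc (toℕ c) * (origin * 3)        ≤⟨ ℕ.+-monoʳ-≤ origin (ℕ.*-monoˡ-≤ (origin * 3) c<c′) ⟩
      anchor c′                                  ∎
      where
      open ℕ.≤-Reasoning
      eq : ∀ o c → o + c * (o * 3) + o * 3 ≡ o + suc c * (o * 3)
      eq = solve-∀

    anchor-far : ∀ {c c′ : Fin (suc κ)} {x y r} → c ≢ c′ → r ≤ origin →
      anchor c ≤ x + r → x ≤ anchor c + (origin + r) →
      anchor c′ ≤ y → y ≤ anchor c′ → x + r ≤ y ⊎ y + r ≤ x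
    anchor-far {c} {c′} {x} {y} {r} c≢c′ r≤o lo hi lo′ hi′ with ℕ.<-cmp (toℕ c) (toℕ c′)
    ... | tri≈ _ eq _ = contradiction (Fin.toℕ-injective eq) c≢c′
    ... | tri< c<c′ _ _ = inj₁ (begin
      x + r                       ≤⟨ ℕ.+-monoˡ-≤ r hi ⟩
      anchor c + (origin + r) + r ≤⟨ ℕ.+-mono-≤ (ℕ.+-monoʳ-≤ (anchor c) (ℕ.+-monoʳ-≤ origin r≤o)) r≤o ⟩
      anchor c + (origin + origin) + origin ≡⟨ eq (anchor c) origin ⟩
      anchor c + origin * 3       ≤⟨ anchor-gap c<c′ ⟩
      anchor c′                   ≤⟨ lo′ ⟩
      y                           ∎)
      where
      open ℕ.≤-Reasoning
      eq : ∀ c o → c + (o + o) + o ≡ c + o * 3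
      eq = solve-∀
    ... | tri> _ _ c′<c = inj₂ (ℕ.+-cancelʳ-≤ r (y + r) x (begin
      y + r + r                   ≤⟨ ℕ.+-mono-≤ (ℕ.+-mono-≤ hi′ r≤o) r≤o ⟩
      anchor c′ + origin + origin ≤⟨ ≤-by origin (eq (anchor c′) origin) ⟩
      anchor c′ + origin * 3      ≤⟨ anchor-gap c′<c ⟩
      anchor c                    ≤⟨ lo ⟩
      x + r                       ∎))
      where
      open ℕ.≤-Reasoning
      eq : ∀ c o → c + o + o + o ≡ c + o * 3
      eq = solve-∀

    base-injective : ∀ {γ γ′} → base γ ≗ base γ′ → γ ≡ γ′
    base-injective {γ} {γ′} base≗ with γ Fin.≟ γ′
    ... | yes γ≡γ′ = γ≡γ′
    ... | no γ≢γ′ = contradiction base≗ (apart (ℕ.≤-total (toℕ (level γ)) (toℕ (level γ′))))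
      where
      close : ∀ c c′ {x y} → x < origin → y < origin → anchor c + x ≡ anchor c′ + y → ¬ toℕ c < toℕ c′
      close c c′ {x} {y} x<o y<o eq c<c′ = ℕ.<⇒≢ (begin-strict
        anchor c + x          <⟨ ℕ.+-monoʳ-< (anchor c) x<o ⟩
        anchor c + origin     ≤⟨ ℕ.+-monoʳ-≤ (anchor c) (ℕ.m≤m*n origin 3) ⟩
        anchor c + origin * 3 ≤⟨ anchor-gap c<c′ ⟩
        anchor c′             ≤⟨ ℕ.m≤m+n _ y ⟩
        anchor c′ + y         ∎) eq
        where open ℕ.≤-Reasoning
      tower≡ : tower γ ≡ tower γ′
      tower≡ with ℕ.<-cmp (toℕ (tower γ)) (toℕ (tower γ′))
      ... | tri≈ _ eq _ = Fin.toℕ-injective eq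
      ... | tri< lt _ _ = contradiction lt (close _ _ (off<origin γ zero) (off<origin γ′ zero) (base≗ zero))
      ... | tri> _ _ gt = contradiction gt (close _ _ (off<origin γ′ zero) (off<origin γ zero) (sym (base≗ zero)))
      off≗ : off γ ≗ off γ′
      off≗ a = ℕ.+-cancelˡ-≡ (anchor (tower γ)) _ _ (trans (base≗ a) (cong (λ c → anchor c + off γ′ a) (sym tower≡)))
      exceeds : ∀ γ {x y} → x + scale γ * 4 ≤ y → x ≢ y
      exceeds γ h = ℕ.<⇒≢ (ℕ.<-≤-trans (ℕ.m<m+n _ (ℕ.<-≤-trans (s≤s z≤n) (ℕ.*-monoˡ-≤ 4 (1≤scale γ)))) h)
      apart : toℕ (level γ) ≤ toℕ (level γ′) ⊎ toℕ (level γ′) ≤ toℕ (level γ) → ¬ base γ ≗ base γ′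
      apart (inj₁ h) _ with off-gap tower≡ γ≢γ′ h
      ... | a , inj₁ g = exceeds γ g (sym (off≗ a))
      ... | a , inj₂ g = exceeds γ g (off≗ a)
      apart (inj₂ h) _ with off-gap (sym tower≡) (γ≢γ′ ∘ sym) h
      ... | a , inj₁ g = exceeds γ′ g (off≗ a)
      ... | a , inj₂ g = exceeds γ′ g (sym (off≗ a))

    -- With γ itself, these label k + 1 places at distance ≥ diam: the anchors of
    -- the other towers and the points γ ± reach along the axes.
    Side : Set
    Side = Fin κ ⊎ (Fin d ⊎ Fin d)

    pattern root u  = inj₁ u
    pattern plus a  = inj₂ (inj₁ a)
    pattern minus a = inj₂ (inj₂ a)

    node : Cell → Side → Fin d → ℕ
    node γ (root u)  = const (anchor (punchIn (tower γ) u))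
    node γ (plus a)  = updateAt (base γ) a (_+ reach (scale γ))
    node γ (minus a) = updateAt (base γ) a (_∸ reach (scale γ))

    -- Lower corners. In direction a, the box of `plus a` starts one step above γ and contains the
    -- node there; that of `minus a` starts at its node and extends past the plane one step below γ.
    -- Elsewhere it starts at the anchor, as `side` exceeds the width of what is left of a tower.
    box : Cell → Side → Fin d → ℕ
    box γ (root u)  = const (anchor (punchIn (tower γ) u))
    box γ (plus a)  = updateAt (const (anchor (tower γ))) a (const (base γ a + scale γ * 4))
    box γ (minus a) = updateAt (const (anchor (tower γ))) a (const (base γ a ∸ reach (scale γ)))

    module _ (γ : Cell) where

      private
        n = scale γ
        c = tower γ
        R = reach n

      base∸R : ∀ a → base γ a ∸ R + R ≡ base γ a
      base∸R a = ℕ.m∸n+n≡m (ℕ.<⇒≤ (reach<base γ a))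

      updated : ∀ {f : Fin d → ℕ} {g} (P : ℕ → Fin d → Set) a → P (g (f a)) a → (∀ b → b ≢ a → P (f b) b) →
        ∀ b → P (updateAt f a g b) b
      updated {f} {g} P a changed kept b with b Fin.≟ a
      ... | yes refl = subst (λ x → P x b) (sym (updateAt-updates b f)) changed
      ... | no b≢a = subst (λ x → P x b) (sym (updateAt-minimal b a f b≢a)) (kept b b≢a)

      NearTower : ℕ → Set
      NearTower x = anchor c ≤ x + R × x ≤ anchor c + (origin + R)

      base-near : ∀ a → NearTower (base γ a)
      base-near a = ℕ.≤-trans (ℕ.m≤m+n _ _) (ℕ.m≤m+n _ R)
                  , ℕ.+-monoʳ-≤ (anchor c) (ℕ.≤-trans (ℕ.<⇒≤ (off<origin γ a)) (ℕ.m≤m+n _ R))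

      plus-near : ∀ a b → NearTower (node γ (plus a) b)
      plus-near a = updated (λ x _ → NearTower x) a
        ( ℕ.≤-trans (ℕ.m≤m+n _ _) (ℕ.≤-trans (ℕ.m≤m+n _ R) (ℕ.m≤m+n _ R))
        , ℕ.≤-trans (ℕ.≤-reflexive (ℕ.+-assoc (anchor c) _ R)) (ℕ.+-monoʳ-≤ (anchor c) (ℕ.+-monoˡ-≤ R (ℕ.<⇒≤ (off<origin γ a)))))
        (λ b _ → base-near b)

      minus-near : ∀ a b → NearTower (node γ (minus a) b)
      minus-near a = updated (λ x _ → NearTower x) a
        ( ℕ.≤-trans (ℕ.m≤m+n _ _) (ℕ.≤-reflexive (sym (base∸R a)))
        , ℕ.≤-trans (ℕ.m∸n≤m _ R) (proj₂ (base-near a)))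
        (λ b _ → base-near b)

      root-far : ∀ u {p : Fin d → ℕ} → (∀ a → NearTower (p a)) → Separated R p (node γ (root u))
      root-far u near = zero , anchor-far (Fin.punchInᵢ≢i c u ∘ sym) (ℕ.<⇒≤ (reach<origin γ))
        (proj₁ (near zero)) (proj₂ (near zero)) ℕ.≤-refl ℕ.≤-refl

      plus-far : ∀ a {p : Fin d → ℕ} → p a ≤ base γ a → Separated R p (node γ (plus a))
      plus-far a {p} h = a , inj₁ (subst (p a + R ≤_) (sym (updateAt-updates a (base γ))) (ℕ.+-monoˡ-≤ R h))

      minus-far : ∀ a {p : Fin d → ℕ} → base γ a ≤ p a → Separated R p (node γ (minus a))
      minus-far a {p} h = a , inj₂ (subst (λ x → x + R ≤ p a) (sym (updateAt-updates a (base γ)))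
        (ℕ.≤-trans (ℕ.≤-reflexive (base∸R a)) h))

      plus-elsewhere : ∀ {a b} → b ≢ a → node γ (plus a) b ≡ base γ b
      plus-elsewhere {a} {b} = updateAt-minimal b a (base γ)

      minus-elsewhere : ∀ {a b} → b ≢ a → node γ (minus a) b ≡ base γ b
      minus-elsewhere {a} {b} = updateAt-minimal b a (base γ)

      minus-≤ : ∀ a b → node γ (minus a) b ≤ base γ b
      minus-≤ a = updated (λ x b → x ≤ base γ b) a (ℕ.m∸n≤m _ R) (λ b _ → ℕ.≤-refl)

      base-node-far : ∀ x → Separated R (base γ) (node γ x)
      base-node-far (root u)  = root-far u base-near
      base-node-far (plus a)  = plus-far a ℕ.≤-refl
      base-node-far (minus a) = minus-far a ℕ.≤-refl

      node-far : ∀ {x y} → x ≢ y → Separated R (node γ x) (node γ y)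
      node-far {root u} {root v} x≢y = zero , anchor-far (x≢y ∘ cong inj₁ ∘ Fin.punchIn-injective c u v)
        (ℕ.<⇒≤ (reach<origin γ)) (ℕ.m≤m+n _ R) (ℕ.m≤m+n _ _) ℕ.≤-refl ℕ.≤-refl
      node-far {plus a}  {root v} _ = root-far v (plus-near a)
      node-far {minus a} {root v} _ = root-far v (minus-near a)
      node-far {root u} {plus a}  _ = Separated-sym (root-far u (plus-near a))
      node-far {root u} {minus a} _ = Separated-sym (root-far u (minus-near a))
      node-far {minus a} {plus b} _ = plus-far b (minus-≤ a b)
      node-far {plus a} {minus b} _ = Separated-sym (plus-far a (minus-≤ b a))
      node-far {plus a} {plus b} x≢y = plus-far b (ℕ.≤-reflexive (plus-elsewhere (λ b≡a → x≢y (cong (inj₂ ∘ inj₁) (sym b≡a)))))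
      node-far {minus a} {minus b} x≢y = minus-far b (ℕ.≤-reflexive (sym (minus-elsewhere (λ b≡a → x≢y (cong (inj₂ ∘ inj₂) (sym b≡a))))))

      -- The strict upper bound leaves room for the segment that replaces the lattice point x.
      Within : ℕ → ℕ → Set
      Within lo x = lo ≤ x × x < lo + side n

      within-tower : ∀ c {x} → x ≤ ℓ * n * 8 → Within (anchor c) (anchor c + x)
      within-tower c h = ℕ.m≤m+n _ _ , ℕ.+-monoʳ-< (anchor c) (ℕ.≤-<-trans h (side>8ℓn (1≤scale γ)))

      within-own : ∀ b → Within (anchor c) (base γ b)
      within-own b = within-tower c (off-≤ γ b)

      box-updated : ∀ (p : Fin d → ℕ) {lo} a → Within lo (p a) → (∀ b → b ≢ a → Within (anchor c) (p b)) →
        ∀ b → Within (updateAt (const (anchor c)) a (const lo) b) (p b)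
      box-updated p a = updated (λ x b → Within x (p b)) a

      node-in-box : ∀ x b → Within (box γ x b) (node γ x b)
      node-in-box (root u) b = ℕ.≤-refl , ℕ.m<m+n _ (ℕ.≤-<-trans z≤n (side>8ℓn (1≤scale γ)))
      node-in-box (plus a) = box-updated (node γ (plus a)) a
        (subst (Within _) (sym (updateAt-updates a (base γ)))
          ( ℕ.+-monoʳ-≤ (base γ a) (ℕ.<⇒≤ (ℕ.≤-trans (s≤s 4n≤) ℕ.≤-refl))
          , ℕ.<-≤-trans (ℕ.+-monoʳ-< (base γ a) (reach<4n+side (1≤scale γ))) (ℕ.≤-reflexive (sym (ℕ.+-assoc (base γ a) _ _)))))
        (λ b b≢a → subst (Within _) (sym (plus-elsewhere b≢a)) (within-own b))
        where
        4n≤ : n * 4 ≤ diam n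
        4n≤ = ≤-by (ℓ * n * 8 + n * 4) (eq (ℓ * n * 8) n)
          where
          eq : ∀ x n → n * 4 + (x + n * 4) ≡ x + n * 8
          eq = solve-∀
      node-in-box (minus a) = box-updated (node γ (minus a)) a
        (subst (Within _) (sym (updateAt-updates a (base γ)))
          (ℕ.≤-refl , ℕ.m<m+n _ (ℕ.≤-<-trans z≤n (side>8ℓn (1≤scale γ)))))
        (λ b b≢a → subst (Within _) (sym (minus-elsewhere b≢a)) (within-own b))

      -- In another tower, scale at most n means that the root box suffices. In the same tower, the
      -- direction in which γ′ is a step above or below γ selects the box.
      later-in-box : ∀ γ′ → γ′ ≢ γ → toℕ (level γ) ≤ toℕ (level γ′) → ∃[ x ] ∀ b → Within (box γ x b) (base γ′ b)
      later-in-box γ′ γ′≢γ level≤ = cases (c Fin.≟ tower γ′)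
        where
        off′≤ : ∀ b → off γ′ b ≤ ℓ * n * 8
        off′≤ b = ℕ.≤-trans (off-≤ γ′ b) (side-mono (scale-antitone {γ} {γ′} level≤))
        within′ : ∀ {c′} → c′ ≡ tower γ′ → ∀ b → Within (anchor c′) (base γ′ b)
        within′ refl b = within-tower (tower γ′) (off′≤ b)
        cases : Dec (c ≡ tower γ′) → ∃[ x ] ∀ b → Within (box γ x b) (base γ′ b)
        cases (no c≢c′) = root (punchOut c≢c′) , within′ (Fin.punchIn-punchOut c≢c′)
        cases (yes c≡c′) with off-gap c≡c′ (γ′≢γ ∘ sym) level≤
        ... | a , inj₂ above = plus a , box-updated (base γ′) a
                ( ℕ.≤-trans (ℕ.≤-reflexive (ℕ.+-assoc (anchor c) _ _))
                    (ℕ.≤-trans (ℕ.+-monoʳ-≤ (anchor c) above) (ℕ.≤-reflexive (cong (λ c → anchor c + off γ′ a) c≡c′)))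
                , ℕ.<-≤-trans (proj₂ (within′ c≡c′ a)) (ℕ.+-monoˡ-≤ (side n) (ℕ.≤-trans (ℕ.m≤m+n (anchor c) (off γ a)) (ℕ.m≤m+n (base γ a) (n * 4)))))
                (λ b _ → within′ c≡c′ b)
        ... | a , inj₁ below = minus a , box-updated (base γ′) a
                ( ℕ.≤-trans (ℕ.m≤n+o⇒m∸n≤o _ R (ℕ.≤-trans (ℕ.+-monoʳ-≤ (anchor c) (off≤reach γ a)) (ℕ.≤-reflexive (ℕ.+-comm (anchor c) R))))
                    (proj₁ (within′ c≡c′ a))
                , ℕ.+-cancelʳ-< (n * 4) _ _ bound)
                (λ b _ → within′ c≡c′ b)
          where
          open ℕ.≤-Reasoning
          -- The step 4n is added on both sides to avoid a further truncated subtraction.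
          bound : base γ′ a + n * 4 < base γ a ∸ R + side n + n * 4
          bound = begin-strict
            anchor (tower γ′) + off γ′ a + n * 4 ≡⟨ cong (λ c → anchor c + off γ′ a + n * 4) c≡c′ ⟨
            anchor c + off γ′ a + n * 4          ≡⟨ ℕ.+-assoc (anchor c) _ _ ⟩
            anchor c + (off γ′ a + n * 4)        ≤⟨ ℕ.+-monoʳ-≤ (anchor c) below ⟩
            base γ a                             ≡⟨ base∸R a ⟨
            base γ a ∸ R + R                     <⟨ ℕ.+-monoʳ-< (base γ a ∸ R) (reach<4n+side (1≤scale γ)) ⟩
            base γ a ∸ R + (n * 4 + side n)      ≡⟨ cong (base γ a ∸ R +_) (ℕ.+-comm (n * 4) (side n)) ⟩
            base γ a ∸ R + (side n + n * 4)      ≡⟨ ℕ.+-assoc (base γ a ∸ R) _ _ ⟨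
            base γ a ∸ R + side n + n * 4        ∎

      -- Coordinates from 1 on become at least 2z + 1, which keeps them clear of the auxiliary
      -- points 0 and 1.
      InSpan : ℕ → Set
      InSpan x = 1 ≤ x × x ≤ suc κ * (origin * 3)

      anchor-top : ∀ (c : Fin (suc κ)) → anchor c + (origin + origin) ≤ suc κ * (origin * 3)
      anchor-top c = ℕ.≤-trans (ℕ.≤-reflexive (eq origin (toℕ c))) (ℕ.*-monoˡ-≤ (origin * 3) (Fin.toℕ<n c))
        where
        eq : ∀ o c → o + c * (o * 3) + (o + o) ≡ suc c * (o * 3)
        eq = solve-∀

      near-in-span : ∀ {x} → 1 ≤ x → NearTower x → InSpan x
      near-in-span 1≤x (_ , hi) = 1≤x , ℕ.≤-trans hi
        (ℕ.≤-trans (ℕ.+-monoʳ-≤ (anchor c) (ℕ.+-monoʳ-≤ origin (ℕ.<⇒≤ (reach<origin γ)))) (anchor-top c))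

      base-in-span : ∀ b → InSpan (base γ b)
      base-in-span b = near-in-span (s≤s z≤n) (base-near b)

      node-in-span : ∀ x b → InSpan (node γ x b)
      node-in-span (root u) b = s≤s z≤n , ℕ.≤-trans (ℕ.m≤m+n _ (origin + origin)) (anchor-top (punchIn c u))
      node-in-span (plus a) b = near-in-span (updated (λ x _ → 1 ≤ x) a (s≤s z≤n) (λ _ _ → s≤s z≤n) b) (plus-near a b)
      node-in-span (minus a) b = near-in-span (updated (λ x _ → 1 ≤ x) a (ℕ.m<n⇒0<n∸m (reach<base γ a)) (λ _ _ → s≤s z≤n) b) (minus-near a b)

  -- Every lattice point is blown up to a diagonal segment of B points.
  module Blocks (B : ℕ) where

    point : ∀ {d} → (Fin d → ℕ) → ℕ → Fin d → ℕ
    point b s a = b a * B + s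

    next-block : ∀ b {s} x → s < B → b * B + s + x * B < (suc b + x) * B
    next-block b {s} x s<B = begin-strict
      b * B + s + x * B <⟨ ℕ.+-monoˡ-< (x * B) (ℕ.+-monoʳ-< (b * B) s<B) ⟩
      b * B + B + x * B ≡⟨ eq b x B ⟩
      (suc b + x) * B   ∎
      where
      open ℕ.≤-Reasoning
      eq : ∀ b x B → b * B + B + x * B ≡ (suc b + x) * B
      eq = solve-∀

    -- Both slots are below B, so they can shorten the distance by less than one block.
    point-separated : ∀ {d D} {b b′ : Fin d → ℕ} {s s′} → s < B → s′ < B →
      Separated (suc D) b b′ → Separated (D * B) (point b s) (point b′ s′)
    point-separated {D = D} s<B s′<B (a , h) = a , Sum.map (gap s<B) (gap s′<B) h
      where
      gap : ∀ {b b′ s s′} → s < B → b + suc D ≤ b′ → b * B + s + D * B ≤ b′ * B + s′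
      gap {b} {b′} {s} {s′} s<B h = ℕ.≤-trans (ℕ.<⇒≤ (next-block b D s<B))
        (ℕ.≤-trans (ℕ.*-monoˡ-≤ B (ℕ.≤-trans (ℕ.≤-reflexive (sym (ℕ.+-suc b D))) h)) (ℕ.m≤m+n (b′ * B) s′))

    block-< : ∀ {b b′ s} s′ → s < B → b < b′ → b * B + s < b′ * B + s′
    block-< {b} {b′} {s} s′ s<B b<b′ = begin-strict
      b * B + s   <⟨ ℕ.+-monoʳ-< (b * B) s<B ⟩
      b * B + B   ≡⟨ ℕ.+-comm (b * B) B ⟩
      suc b * B   ≤⟨ ℕ.*-monoˡ-≤ B b<b′ ⟩
      b′ * B      ≤⟨ ℕ.m≤m+n (b′ * B) s′ ⟩
      b′ * B + s′ ∎
      where open ℕ.≤-Reasoning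

    block-≡ : ∀ {b b′ s s′} → s < B → s′ < B → b * B + s ≡ b′ * B + s′ → b ≡ b′
    block-≡ {b} {b′} {s} {s′} s<B s′<B eq with ℕ.<-cmp b b′
    ... | tri≈ _ b≡b′ _ = b≡b′
    ... | tri< b<b′ _ _ = contradiction eq (ℕ.<⇒≢ (block-< s′ s<B b<b′))
    ... | tri> _ _ b′<b = contradiction (sym eq) (ℕ.<⇒≢ (block-< s s′<B b′<b))

    point-injective : ∀ {d} {b b′ : Fin (suc d) → ℕ} {s s′} → s < B → s′ < B →
      point b s ≗ point b′ s′ → b ≗ b′ × s ≡ s′
    point-injective {b = b} {b′} {s} {s′} s<B s′<B eq = b≗b′ ,
        ℕ.+-cancelˡ-≡ (b zero * B) s s′ (trans (eq zero) (cong (λ x → x * B + s′) (sym (b≗b′ zero))))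
      where
      b≗b′ : b ≗ b′
      b≗b′ a = block-≡ s<B s′<B (eq a)

    point-in-box : ∀ {d E} {lo b : Fin d → ℕ} {s} → s < B → (∀ a → lo a ≤ b a × b a < lo a + E) →
      InBox (λ a → lo a * B) (E * B) (point b s)
    point-in-box {E = E} {lo} {b} {s} s<B h a =
        ℕ.≤-trans (ℕ.*-monoˡ-≤ B (proj₁ (h a))) (ℕ.m≤m+n _ s)
      , (begin
          b a * B + s       ≤⟨ ℕ.+-monoʳ-≤ (b a * B) (ℕ.<⇒≤ s<B) ⟩
          b a * B + B       ≡⟨ ℕ.+-comm (b a * B) B ⟩
          suc (b a) * B     ≤⟨ ℕ.*-monoˡ-≤ B (proj₂ (h a)) ⟩
          (lo a + E) * B    ≡⟨ ℕ.*-distribʳ-+ B (lo a) E ⟩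
          lo a * B + E * B  ∎)
      where open ℕ.≤-Reasoning

  -- The points of the prefix, and the continuation for each of them.

  module Elements (e ℓ κ J z : ℕ) where

    open Towers e ℓ κ J public

    private d = suc e

    k : ℕ
    k = κ + (d + d)

    side-of : Fin k → Side
    side-of = Sum.map₂ (splitAt d) ∘ splitAt κ

    of-side : Side → Fin k
    of-side = join κ (d + d) ∘ Sum.map₂ (join d d)

    side-of-side : ∀ x → side-of (of-side x) ≡ x
    side-of-side x = trans (cong (Sum.map₂ (splitAt d)) (Fin.splitAt-join κ (d + d) (Sum.map₂ (join d d) x))) (inner x)
      where
      inner : ∀ x → Sum.map₂ (splitAt d) (Sum.map₂ (join d d) x) ≡ x
      inner (inj₁ u) = refl
      inner (inj₂ y) = cong inj₂ (Fin.splitAt-join d d y)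

    of-side-of : ∀ y → of-side (side-of y) ≡ y
    of-side-of y = trans (cong (join κ (d + d)) (inner (splitAt κ y))) (Fin.join-splitAt κ (d + d) y)
      where
      inner : ∀ x → Sum.map₂ (join d d) (Sum.map₂ (splitAt d) x) ≡ x
      inner (inj₁ u) = refl
      inner (inj₂ y) = cong inj₂ (Fin.join-splitAt d d y)

    side-of-injective : ∀ {x y} → side-of x ≡ side-of y → x ≡ y
    side-of-injective {x} {y} eq = trans (sym (of-side-of x)) (trans (cong of-side eq) (of-side-of y))

    -- Slots 0 to z - 1 of a segment are for the original points, z to 2z for later arrivals. So a
    -- new point cannot collide with an old one, even if a node falls on another cell.
    B : ℕ
    B = suc (z + z)

    open Blocks B public

    N : ℕ
    N = (suc J * (suc κ * ℓ ^ d)) * z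

    private module Index = Digits {suc J * (suc κ * ℓ ^ d)} z

    cell : Fin N → Cell
    cell = Index.high

    spot : Fin N → Fin z
    spot = Index.low

    old : Fin N → Fin d → ℕ
    old i = point (base (cell i)) (toℕ (spot i))

    extent : ℕ
    extent = suc (suc κ * (origin * 3)) * B

    -- The continuation that makes the expiration of the i-th point matter: it puts
    -- z + 1 points at each node of its cell γ, and as many points at γ as have
    -- expired there once the i-th point has expired.
    module Extension (i : Fin N) where

      private
        γ = cell i
        l = toℕ (spot i)
        n = scale γ

      M : ℕ
      M = suc l + k * suc z

      Elem : Set
      Elem = Fin N ⊎ (Fin (suc l) ⊎ (Fin k × Fin (suc z)))

      core : Elem → Fin d → ℕ
      core (inj₁ j)              = base (cell j)
      core (inj₂ (inj₁ v))       = base γ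
      core (inj₂ (inj₂ (x , s))) = node γ (side-of x)

      spotᵉ : Elem → ℕ
      spotᵉ (inj₁ j)              = toℕ (spot j)
      spotᵉ (inj₂ (inj₁ v))       = z + toℕ v
      spotᵉ (inj₂ (inj₂ (x , s))) = z + toℕ s

      decode : Fin M → Fin (suc l) ⊎ (Fin k × Fin (suc z))
      decode = Sum.map₂ (remQuot (suc z)) ∘ splitAt (suc l)

      encode : Fin (suc l) ⊎ (Fin k × Fin (suc z)) → Fin M
      encode = join (suc l) (k * suc z) ∘ Sum.map₂ (uncurry combine)

      decode-encode : ∀ y → decode (encode y) ≡ y
      decode-encode y = trans (cong (Sum.map₂ (remQuot (suc z))) (Fin.splitAt-join (suc l) (k * suc z) (Sum.map₂ (uncurry combine) y))) (inner y)
        where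
        inner : ∀ y → Sum.map₂ (remQuot (suc z)) (Sum.map₂ (uncurry combine) y) ≡ y
        inner (inj₁ v)       = refl
        inner (inj₂ (x , s)) = cong inj₂ (Fin.remQuot-combine x s)

      encode-decode : ∀ j → encode (decode j) ≡ j
      encode-decode j = trans (cong (join (suc l) (k * suc z)) (inner (splitAt (suc l) j))) (Fin.join-splitAt (suc l) (k * suc z) j)
        where
        inner : ∀ y → Sum.map₂ (uncurry combine) (Sum.map₂ (remQuot {k} (suc z)) y) ≡ y
        inner (inj₁ v) = refl
        inner (inj₂ w) = cong inj₂ (Fin.combine-remQuot {k} (suc z) w)

      element : Fin (N + M) → Elem
      element = Sum.map₂ decode ∘ splitAt N

      position : Elem → Fin (N + M)
      position = join N M ∘ Sum.map₂ encode

      element-position : ∀ x → element (position x) ≡ x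
      element-position x = trans (cong (Sum.map₂ decode) (Fin.splitAt-join N M (Sum.map₂ encode x))) (inner x)
        where
        inner : ∀ x → Sum.map₂ decode (Sum.map₂ encode x) ≡ x
        inner (inj₁ j) = refl
        inner (inj₂ y) = cong inj₂ (decode-encode y)

      position-element : ∀ j → position (element j) ≡ j
      position-element j = trans (cong (join N M) (inner (splitAt N j))) (Fin.join-splitAt N M j)
        where
        inner : ∀ x → Sum.map₂ encode (Sum.map₂ decode x) ≡ x
        inner (inj₁ j) = refl
        inner (inj₂ y) = cong inj₂ (encode-decode y)

      element-injective : ∀ {j j′} → element j ≡ element j′ → j ≡ j′
      element-injective {j} {j′} eq = trans (sym (position-element j)) (trans (cong position eq) (position-element j′))

      new : Fin M → Fin d → ℕ
      new j = point (core (inj₂ (decode j))) (spotᵉ (inj₂ (decode j)))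

      all : Fin (N + M) → Fin d → ℕ
      all = old ++ new

      all≡ : ∀ j → all j ≡ point (core (element j)) (spotᵉ (element j))
      all≡ j with splitAt N j
      ... | inj₁ _ = refl
      ... | inj₂ _ = refl

      spotᵉ<B : ∀ x → spotᵉ x < B
      spotᵉ<B (inj₁ j)              = ℕ.<-≤-trans (Fin.toℕ<n (spot j)) (ℕ.m≤n⇒m≤1+n (ℕ.m≤m+n z z))
      spotᵉ<B (inj₂ (inj₁ v))       = s≤s (ℕ.+-monoʳ-≤ z (ℕ.≤-trans (ℕ.s≤s⁻¹ (Fin.toℕ<n v)) (ℕ.<⇒≤ (Fin.toℕ<n (spot i)))))
      spotᵉ<B (inj₂ (inj₂ (x , s))) = s≤s (ℕ.+-monoʳ-≤ z (ℕ.s≤s⁻¹ (Fin.toℕ<n s)))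

      core-spot-injective : ∀ x y → core x ≗ core y → spotᵉ x ≡ spotᵉ y → x ≡ y
      core-spot-injective (inj₁ j) (inj₁ j′) cores spots =
        cong inj₁ (Index.high-low-injective (base-injective cores) (Fin.toℕ-injective spots))
      core-spot-injective (inj₁ j) (inj₂ (inj₁ v)) _ spots = contradiction spots (ℕ.<⇒≢ (ℕ.<-≤-trans (Fin.toℕ<n (spot j)) (ℕ.m≤m+n z _)))
      core-spot-injective (inj₁ j) (inj₂ (inj₂ _)) _ spots = contradiction spots (ℕ.<⇒≢ (ℕ.<-≤-trans (Fin.toℕ<n (spot j)) (ℕ.m≤m+n z _)))
      core-spot-injective (inj₂ (inj₁ v)) (inj₁ j) _ spots = contradiction (sym spots) (ℕ.<⇒≢ (ℕ.<-≤-trans (Fin.toℕ<n (spot j)) (ℕ.m≤m+n z _)))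
      core-spot-injective (inj₂ (inj₂ _)) (inj₁ j) _ spots = contradiction (sym spots) (ℕ.<⇒≢ (ℕ.<-≤-trans (Fin.toℕ<n (spot j)) (ℕ.m≤m+n z _)))
      core-spot-injective (inj₂ (inj₁ v)) (inj₂ (inj₁ w)) _ spots = cong (inj₂ ∘ inj₁) (Fin.toℕ-injective (ℕ.+-cancelˡ-≡ z _ _ spots))
      core-spot-injective (inj₂ (inj₁ v)) (inj₂ (inj₂ (x , s))) cores _ =
        contradiction cores (Separated⇒¬≗ (s≤s z≤n) (base-node-far γ (side-of x)))
      core-spot-injective (inj₂ (inj₂ (x , s))) (inj₂ (inj₁ v)) cores _ =
        contradiction (sym ∘ cores) (Separated⇒¬≗ (s≤s z≤n) (base-node-far γ (side-of x)))
      core-spot-injective (inj₂ (inj₂ (x , s))) (inj₂ (inj₂ (y , t))) cores spots with x Fin.≟ y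
      ... | yes refl = cong (λ s → inj₂ (inj₂ (x , s))) (Fin.toℕ-injective (ℕ.+-cancelˡ-≡ z _ _ spots))
      ... | no x≢y = contradiction cores (Separated⇒¬≗ (s≤s z≤n) (node-far γ (x≢y ∘ side-of-injective)))

      index-≡ : ∀ {j j′} → core (element j) ≗ core (element j′) → spotᵉ (element j) ≡ spotᵉ (element j′) → j ≡ j′
      index-≡ {j} {j′} cores spots = element-injective (core-spot-injective (element j) (element j′) cores spots)

      all-separated : ∀ {j j′} → j ≢ j′ → Separated 1 (all j) (all j′)
      all-separated {j} {j′} j≢j′ = subst₂ (Separated 1) (sym (all≡ j)) (sym (all≡ j′)) (¬≗⇒Separated λ eq →
        j≢j′ (uncurry index-≡ (point-injective {b = core (element j)} {core (element j′)} (spotᵉ<B (element j)) (spotᵉ<B (element j′)) eq)))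

      core-in-span : ∀ x b → 1 ≤ core x b × core x b ≤ suc κ * (origin * 3)
      core-in-span (inj₁ j)              = base-in-span (cell j)
      core-in-span (inj₂ (inj₁ v))       = base-in-span γ
      core-in-span (inj₂ (inj₂ (x , s))) = node-in-span γ (side-of x)

      2≤all : 1 ≤ z → ∀ j a → 2 ≤ all j a
      2≤all 1≤z j a = subst (λ p → 2 ≤ p a) (sym (all≡ j)) (begin
        2                          ≤⟨ s≤s (ℕ.≤-trans 1≤z (ℕ.m≤m+n z z)) ⟩
        B                          ≡⟨ ℕ.*-identityˡ B ⟨
        1 * B                      ≤⟨ ℕ.*-monoˡ-≤ B (proj₁ (core-in-span (element j) a)) ⟩
        core (element j) a * B     ≤⟨ ℕ.m≤m+n _ _ ⟩
        core (element j) a * B + spotᵉ (element j) ∎)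
        where open ℕ.≤-Reasoning

      all< : ∀ j a → all j a < extent
      all< j a = subst (λ p → p a < extent) (sym (all≡ j)) (begin-strict
        core (element j) a * B + spotᵉ (element j) <⟨ ℕ.+-monoʳ-< (core (element j) a * B) (spotᵉ<B (element j)) ⟩
        core (element j) a * B + B                 ≡⟨ ℕ.+-comm _ B ⟩
        suc (core (element j) a) * B               ≤⟨ ℕ.*-monoˡ-≤ B (s≤s (proj₂ (core-in-span (element j) a))) ⟩
        extent                                     ∎)
        where open ℕ.≤-Reasoning

      toℕ-position-old : ∀ j → toℕ (position (inj₁ j)) ≡ toℕ j
      toℕ-position-old j = Fin.toℕ-↑ˡ j M

      position-new> : ∀ y → toℕ i < toℕ (position (inj₂ y))
      position-new> y = ℕ.<-≤-trans (Fin.toℕ<n i) (ℕ.≤-trans (ℕ.m≤m+n N _) (ℕ.≤-reflexive (sym (Fin.toℕ-↑ʳ N (encode y)))))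

      -- From point i on, the segment of γ holds z - l old points in slots l to z - 1 and l + 1 new
      -- ones in slots z to z + l. These are z + 1 points, one too many to be all outliers.
      centre : ∀ v → l ≤ v → v ≤ l + z → ∃[ x ] core x ≡ base γ × spotᵉ x ≡ v × toℕ i ≤ toℕ (position x)
      centre v l≤v v≤l+z with v ℕ.<? z
      ... | yes v<z = inj₁ j , cong base (cong proj₁ j-digits) ,
          trans (cong (toℕ ∘ proj₂) j-digits) (Fin.toℕ-fromℕ< v<z) ,
          (begin
            toℕ i                           ≡⟨ cong toℕ (Index.combine-high-low i) ⟨
            toℕ (combine γ (spot i))        ≡⟨ Fin.toℕ-combine γ (spot i) ⟩
            z * toℕ γ + l                   ≤⟨ ℕ.+-monoʳ-≤ (z * toℕ γ) l≤v ⟩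
            z * toℕ γ + v                   ≡⟨ cong (z * toℕ γ +_) (Fin.toℕ-fromℕ< v<z) ⟨
            z * toℕ γ + toℕ (fromℕ< v<z)    ≡⟨ Fin.toℕ-combine γ (fromℕ< v<z) ⟨
            toℕ j                           ≡⟨ toℕ-position-old j ⟨
            toℕ (position (inj₁ j))         ∎)
        where
        open ℕ.≤-Reasoning
        j : Fin N
        j = combine γ (fromℕ< v<z)
        j-digits : remQuot z j ≡ (γ , fromℕ< v<z)
        j-digits = Fin.remQuot-combine γ (fromℕ< v<z)
      ... | no v≮z = inj₂ (inj₁ (fromℕ< w<)) , refl ,
          trans (cong (z +_) (Fin.toℕ-fromℕ< w<)) (ℕ.m+[n∸m]≡n (ℕ.≮⇒≥ v≮z)) ,
          ℕ.<⇒≤ (position-new> (inj₁ (fromℕ< w<)))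
        where
        w< : v ∸ z < suc l
        w< = s≤s (ℕ.m≤n+o⇒m∸n≤o v z (ℕ.≤-trans v≤l+z (ℕ.≤-reflexive (ℕ.+-comm l z))))

      centre-elem : (s : Fin (suc z)) → ∃[ x ] core x ≡ base γ × spotᵉ x ≡ l + toℕ s × toℕ i ≤ toℕ (position x)
      centre-elem s = centre (l + toℕ s) (ℕ.m≤m+n l _) (ℕ.+-monoʳ-≤ l (ℕ.s≤s⁻¹ (Fin.toℕ<n s)))

      group-core : Fin (suc k) → Fin d → ℕ
      group-core zero    = base γ
      group-core (suc x) = node γ (side-of x)

      group-elem : Fin (suc k) → Fin (suc z) → Elem
      group-elem zero    s = proj₁ (centre-elem s)
      group-elem (suc x) s = inj₂ (inj₂ (x , s))

      group : Fin (suc k) → Fin (suc z) → Fin (N + M)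
      group g s = position (group-elem g s)

      core-group : ∀ g s → core (group-elem g s) ≡ group-core g
      core-group zero    s = proj₁ (proj₂ (centre-elem s))
      core-group (suc x) s = refl

      group-injective : ∀ g {s t} → group g s ≡ group g t → s ≡ t
      group-injective g {s} {t} eq = spots g (trans (sym (element-position (group-elem g s))) (trans (cong element eq) (element-position (group-elem g t))))
        where
        spots : ∀ g → group-elem g s ≡ group-elem g t → s ≡ t
        spots zero eq = Fin.toℕ-injective (ℕ.+-cancelˡ-≡ l _ _
          (trans (sym (proj₁ (proj₂ (proj₂ (centre-elem s))))) (trans (cong spotᵉ eq) (proj₁ (proj₂ (proj₂ (centre-elem t)))))))
        spots (suc x) eq = cong proj₂ (Sum.inj₂-injective (Sum.inj₂-injective eq))

      group-≥ : ∀ g s → toℕ i ≤ toℕ (group g s)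
      group-≥ zero    s = proj₂ (proj₂ (proj₂ (centre-elem s)))
      group-≥ (suc x) s = ℕ.<⇒≤ (position-new> (inj₂ (x , s)))

      group-core-far : ∀ {g g′} → g ≢ g′ → Separated (reach n) (group-core g) (group-core g′)
      group-core-far {zero}  {zero}  g≢g′ = contradiction refl g≢g′
      group-core-far {zero}  {suc x} _    = base-node-far γ (side-of x)
      group-core-far {suc x} {zero}  _    = Separated-sym (base-node-far γ (side-of x))
      group-core-far {suc x} {suc y} g≢g′ = node-far γ (g≢g′ ∘ cong suc ∘ side-of-injective)

      all-position : ∀ x → all (position x) ≡ point (core x) (spotᵉ x)
      all-position x = trans (all≡ (position x)) (cong (λ y → point (core y) (spotᵉ y)) (element-position x))

      groups-far : ∀ {g g′} → g ≢ g′ → ∀ s s′ → Separated (diam n * B) (all (group g s)) (all (group g′ s′))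
      groups-far {g} {g′} g≢g′ s s′ = subst₂ (Separated (diam n * B)) (sym (all-position (group-elem g s))) (sym (all-position (group-elem g′ s′)))
        (point-separated (spotᵉ<B (group-elem g s)) (spotᵉ<B (group-elem g′ s′))
          (subst₂ (Separated (reach n)) (sym (core-group g s)) (sym (core-group g′ s′)) (group-core-far g≢g′)))

      -- Slot l, which belongs to point i, is skipped: once i has expired, exactly z points are left
      -- at γ.
      outlier : Fin z → Fin (N + M)
      outlier u = group zero (suc u)

      corner : Fin k → Fin d → ℕ
      corner x a = box γ (side-of x) a * B

      centre-outlier : ∀ x → core x ≡ base γ → l < spotᵉ x → spotᵉ x ≤ l + z → ∃[ u ] position x ≡ outlier u
      centre-outlier x core≡ l<spot spot≤ = u , cong position (core-spot-injective x (group-elem zero (suc u))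
          (λ a → cong (λ b → b a) (trans core≡ (sym (core-group zero (suc u)))))
          (trans (sym l+u) (sym (proj₁ (proj₂ (proj₂ (centre-elem (suc u))))))))
        where
        w = proj₁ (<⇒∃ l<spot)
        l+w : suc l + w ≡ spotᵉ x
        l+w = proj₂ (<⇒∃ l<spot)
        w<z : w < z
        w<z = ℕ.+-cancelˡ-≤ l _ _ (ℕ.≤-trans (ℕ.≤-reflexive (trans (ℕ.+-suc l w) l+w)) spot≤)
        u : Fin z
        u = fromℕ< w<z
        l+u : l + suc (toℕ u) ≡ spotᵉ x
        l+u = trans (ℕ.+-suc l _) (trans (cong (suc l +_) (Fin.toℕ-fromℕ< w<z)) l+w)

      Covered : Elem → Set
      Covered x = (∃[ u ] position x ≡ outlier u) ⊎ (∃[ y ] InBox (corner y) (side n * B) (point (core x) (spotᵉ x)))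

      in-box : ∀ x y → (∀ b → Within γ (box γ y b) (core x b)) → Covered x
      in-box x y h = inj₂ (of-side y , subst (λ y → InBox (λ a → box γ y a * B) (side n * B) (point (core x) (spotᵉ x))) (sym (side-of-side y))
        (point-in-box {lo = box γ y} {core x} (spotᵉ<B x) h))

      later-covered : ∀ x → toℕ i < toℕ (position x) → Covered x
      later-covered (inj₁ j) i<j = cases (cell j Fin.≟ γ)
        where
        i<j′ : toℕ i < toℕ j
        i<j′ = subst (toℕ i <_) (toℕ-position-old j) i<j
        cases : Dec (cell j ≡ γ) → Covered (inj₁ j)
        cases (yes same) = inj₁ (centre-outlier (inj₁ j) (cong base same) (Index.low-mono-< (sym same) i<j′)
          (ℕ.≤-trans (ℕ.<⇒≤ (Fin.toℕ<n (spot j))) (ℕ.m≤n+m z l)))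
        cases (no other) = let x , h = later-in-box γ (cell j) other (level-mono-≤ (Index.high-mono-≤ (ℕ.<⇒≤ i<j′))) in in-box (inj₁ j) x h
      later-covered (inj₂ (inj₁ v)) _ = inj₁ (centre-outlier (inj₂ (inj₁ v)) refl
        (ℕ.<-≤-trans (Fin.toℕ<n (spot i)) (ℕ.m≤m+n z _))
        (ℕ.≤-trans (ℕ.+-monoʳ-≤ z (ℕ.s≤s⁻¹ (Fin.toℕ<n v))) (ℕ.≤-reflexive (ℕ.+-comm z l))))
      later-covered (inj₂ (inj₂ (x , s))) _ = in-box (inj₂ (inj₂ (x , s))) (side-of x) (node-in-box γ (side-of x))

      all-covered : ∀ j → toℕ i < toℕ j → (∃[ u ] j ≡ outlier u) ⊎ (∃[ y ] InBox (corner y) (side n * B) (all j))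
      all-covered j i<j = Sum.map
        (Product.map₂ (trans (sym (position-element j))))
        (Product.map₂ (λ {y} → subst (InBox (corner y) (side n * B)) (sym (all≡ j))))
        (later-covered (element j) (subst (λ j → toℕ i < toℕ j) (sym (position-element j)) i<j))

open Lattice

last-true : ∀ {P : ℕ → Set} → Decidable P → P 0 → ∀ n → ¬ P n → ∃[ m ] P m × ¬ P (suc m)
last-true P? p0 zero ¬p0 = contradiction p0 ¬p0
last-true P? p0 (suc n) ¬pn with P? n
... | yes pn = n , pn , ¬pn
... | no ¬pn′ = last-true P? p0 n ¬pn′

n<2^n : ∀ n → n ℕ.< 2 ℕ.^ n
n<2^n zero = ℕ.s≤s ℕ.z≤n
n<2^n (suc n) = ℕ.≤-trans (ℕ.s≤s (n<2^n n))
  (ℕ.≤-trans (ℕ.+-monoˡ-≤ (2 ℕ.^ n) (ℕ.m^n>0 2 n)) (ℕ.+-monoʳ-≤ (2 ℕ.^ n) (ℕ.m≤m+n (2 ℕ.^ n) 0)))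

-- The streams over the field, and the number of expiration times in use.

module Construction (ℝ : RealField) where

  open LatticeStreams ℝ public

  module _ (e ℓ κ J z : ℕ) (1≤z : 1 ℕ.≤ z) where

    open Elements e ℓ κ J z
    private d = suc e

    module _ (ε σ W : Carrier) (0<ε : 0# < ε) (0<W : 0# < W)
             (ε-grid : ε * fromℕ (suc ℓ ℕ.* 8) ≤ 1#) (extent≤σ : fromℕ extent ≤ σ) where

      ε≤1 : ε ≤ 1#
      ε≤1 = ≤-trans (≤-resp (*-identityʳ ε) refl (*-monoʳ-≤ (<⇒≤ 0<ε) (≤-resp fromℕ-1 refl (fromℕ-mono-≤ 1≤8+8ℓ)))) ε-grid
        where
        1≤8+8ℓ : 1 ℕ.≤ suc ℓ ℕ.* 8
        1≤8+8ℓ = ℕ.s≤s ℕ.z≤n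

      0≤1-ε : 0# ≤ 1# - ε
      0≤1-ε = x≤y⇒0≤y-x ε≤1

      0≤1+ε : 0# ≤ 1# + ε
      0≤1+ε = ≤-trans 0≤1 (x≤x+y 1# (<⇒≤ 0<ε))

      -- Cancelling nB leaves (1 - ε)x ≤ (1 + ε)y with x = 8(ℓ + 1) and y = x - 2, that is, 2 ≤ ε(x
      -- + y) = 2εx - 2ε. As εx ≤ 1, this forces ε ≤ 0.
      ratio-gap : ∀ n → 1 ℕ.≤ n → ¬ (1# - ε) * fromℕ (diam n ℕ.* B) ≤ (1# + ε) * fromℕ (side n ℕ.* B)
      ratio-gap n 1≤n h = <⇒≱ 0<ε (+-cancelʳ-≤ ε (≤-trans ε+ε≤0 (≤-trans (<⇒≤ 0<ε) (≤-reflexive (sym (+-identityˡ ε))))))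
        where
        x = fromℕ (suc ℓ ℕ.* 8)
        y = fromℕ (ℓ ℕ.* 8 ℕ.+ 6)
        v = fromℕ (n ℕ.* B)
        diam≡ : ∀ ℓ n B → (ℓ ℕ.* n ℕ.* 8 ℕ.+ n ℕ.* 8) ℕ.* B ≡ suc ℓ ℕ.* 8 ℕ.* (n ℕ.* B)
        diam≡ = solve-∀
        side≡ : ∀ ℓ n B → (ℓ ℕ.* n ℕ.* 8 ℕ.+ n ℕ.* 6) ℕ.* B ≡ (ℓ ℕ.* 8 ℕ.+ 6) ℕ.* (n ℕ.* B)
        side≡ = solve-∀
        8+8ℓ≡ : ∀ ℓ → suc ℓ ℕ.* 8 ≡ (ℓ ℕ.* 8 ℕ.+ 6) ℕ.+ 2
        8+8ℓ≡ = solve-∀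
        0<v : 0# < v
        0<v = fromℕ-pos (ℕ.*-mono-≤ 1≤n (ℕ.s≤s ℕ.z≤n))
        D≈ : (1# - ε) * fromℕ (diam n ℕ.* B) ≈ (1# - ε) * x * v
        D≈ = trans (*-congˡ (trans (reflexive (≡.cong fromℕ (diam≡ ℓ n B))) (fromℕ-* (suc ℓ ℕ.* 8) (n ℕ.* B)))) (sym (*-assoc _ _ _))
        E≈ : (1# + ε) * fromℕ (side n ℕ.* B) ≈ (1# + ε) * y * v
        E≈ = trans (*-congˡ (trans (reflexive (≡.cong fromℕ (side≡ ℓ n B))) (fromℕ-* (ℓ ℕ.* 8 ℕ.+ 6) (n ℕ.* B)))) (sym (*-assoc _ _ _))
        scaled : (1# - ε) * x ≤ (1# + ε) * y
        scaled = *-cancelʳ-≤ 0<v (≤-resp D≈ E≈ h)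
        x≈ : x ≈ y + (1# + 1#)
        x≈ = trans (reflexive (≡.cong fromℕ (8+8ℓ≡ ℓ))) (trans (fromℕ-+ (ℓ ℕ.* 8 ℕ.+ 6) 2) (+-congˡ (+-congˡ (+-identityʳ 1#))))
        2≤ : 1# + 1# ≤ ε * y + ε * x
        2≤ = +-cancelˡ-≤ y (begin
          y + (1# + 1#)            ≈⟨ x≈ ⟨
          x                        ≈⟨ *-identityˡ x ⟨
          1# * x                   ≈⟨ *-congʳ (x-y+y≈x 1# ε) ⟨
          (1# - ε + ε) * x         ≈⟨ distribʳ x _ _ ⟩
          (1# - ε) * x + ε * x     ≤⟨ +-monoˡ-≤ (ε * x) scaled ⟩
          (1# + ε) * y + ε * x     ≈⟨ solve 3 (λ ε x y → (con 1 :+ ε) :* y :+ ε :* x := y :+ (ε :* y :+ ε :* x)) refl ε x y ⟩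
          y + (ε * y + ε * x)      ∎)
        ε+ε≤0 : ε + ε ≤ 0#
        ε+ε≤0 = +-cancelˡ-≤ (1# + 1#) (begin
          1# + 1# + (ε + ε)                    ≤⟨ +-monoˡ-≤ (ε + ε) 2≤ ⟩
          ε * y + ε * x + (ε + ε)              ≈⟨ solve 3 (λ ε x y → ε :* y :+ ε :* x :+ (ε :+ ε) := ε :* (y :+ (con 1 :+ con 1)) :+ ε :* x) refl ε x y ⟩
          ε * (y + (1# + 1#)) + ε * x          ≈⟨ +-congʳ (*-congˡ x≈) ⟨
          ε * x + ε * x                        ≤⟨ +-mono-≤ ε-grid ε-grid ⟩
          1# + 1#                              ≈⟨ +-identityʳ _ ⟨
          1# + 1# + 0#                         ∎)

      prefixed : ∀ {n} → (Fin n → Fin d → ℕ) → Fin (3 ℕ.+ n) → Point d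
      prefixed f zero                = const 0#
      prefixed f (suc zero)          = const 1#
      prefixed f (suc (suc zero))    = const σ
      prefixed f (suc (suc (suc i))) = embed (f i)

      -- All streams have at most T points, so that with arrivals δ apart no point
      -- expires before the last one has arrived.
      T : ℕ
      T = 3 ℕ.+ N ℕ.+ (z ℕ.+ k ℕ.* suc z)

      δ : Carrier
      δ = W / fromℕ T

      0<T : 0# < fromℕ T
      0<T = fromℕ-pos {T} (ℕ.s≤s ℕ.z≤n)

      0<δ : 0# < δ
      0<δ = x/y-pos 0<W 0<T

      early : ∀ {n} → n ℕ.≤ T → fromℕ n * δ ≤ W
      early {n} n≤T = ≤-trans (*-monoˡ-≤ (<⇒≤ 0<δ) (fromℕ-mono-≤ n≤T))
        (≤-reflexive (trans (*-comm (fromℕ T) δ) (x/z*z≈x 0<T)))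

      2≤σ : fromℕ 2 ≤ σ
      2≤σ = ≤-trans (fromℕ-mono-≤ (ℕ.≤-trans (ℕ.s≤s (ℕ.≤-trans 1≤z (ℕ.m≤m+n z z))) (ℕ.m≤m+n B _))) extent≤σ

      <extent : ∀ {x} → x ℕ.< extent → fromℕ (suc x) ≤ σ
      <extent h = ≤-trans (fromℕ-mono-≤ h) extent≤σ

      P₀ : Stream d
      P₀ = stream δ (<⇒≤ 0<δ) (3 ℕ.+ N) (prefixed old)

      old≡all : ∀ i j → old j ≡ Extension.all i (j ↑ˡ Extension.M i)
      old≡all i j = ≡.sym (lookup-++ˡ old (Extension.new i) j)

      -- `SpaceBound` refers to streams of spread σ, so the prefix on which space is measured needs
      -- it too. Its lattice points inherit their properties from the extension that belongs to the
      -- index at hand.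
      spread₀ : HasSpread P₀ σ
      spread₀ = has-spread δ (<⇒≤ 0<δ) (prefixed old) old (λ _ → ≡.refl) σ ≡.refl ≡.refl ≡.refl
        (λ {i} {j} i≢j → ≡.subst₂ (Separated 1) (≡.sym (old≡all i i)) (≡.sym (old≡all i j))
          (Extension.all-separated i (i≢j ∘ Fin.↑ˡ-injective _ i j)))
        (λ i a → ≡.subst (λ p → 2 ℕ.≤ p a) (≡.sym (old≡all i i)) (Extension.2≤all i 1≤z _ a))
        (λ i a → <extent (≡.subst (λ p → p a ℕ.< extent) (≡.sym (old≡all i i)) (Extension.all< i _ a)))
        2≤σ

      module _ (A : Algorithm d) (adheres : Adheres W A) (solves : Solves σ A W k z ε) where

        open Algorithm A using (S; Unused)

        t* : Time
        t* = fromℕ (2 ℕ.+ N) * δ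

        used : ∀ (i : Fin N) → ¬ Unused P₀ t* (expires W 0<W δ 0<δ A adheres (toℕ (3 ↑ʳ i)))
        used i = forced W 0<W δ 0<δ A adheres (prefixed old) (embed ∘ new) (early total≤T) {σ = σ}
            (k-nonempty) 0≤1-ε 0≤1+ε solves spread (3 ↑ʳ i) ≡.refl (fromℕ-nonneg (side n ℕ.* B))
            (lower-bound δ 0≤δ h all h-lattice W {t = before} {D = diam n ℕ.* B} group group-injective
              (λ g s → active⁺ W 0<W δ 0<δ A adheres h (early total≤T) {2 ℕ.+ toℕ i} (3 ↑ʳ group g s) (ℕ.s≤s (ℕ.s≤s (ℕ.s≤s (group-≥ g s)))))
              groups-far)
            (upper-bound δ 0≤δ h all h-lattice W {t = after} {E = side n ℕ.* B} corner outlier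
              (λ a act → ℕ.<⇒≱ (active⁻ W 0<W δ 0<δ A adheres h (early total≤T) {3 ℕ.+ toℕ i} (a ↑ˡ (N ℕ.+ M)) act)
                (ℕ.≤-trans (ℕ.≤-reflexive (Fin.toℕ-↑ˡ a (N ℕ.+ M))) (ℕ.≤-trans (ℕ.<⇒≤ (Fin.toℕ<n a)) (ℕ.m≤m+n 3 (toℕ i)))))
              (λ j act → all-covered j (ℕ.s≤s⁻¹ (ℕ.s≤s⁻¹ (ℕ.s≤s⁻¹
                (active⁻ W 0<W δ 0<δ A adheres h (early total≤T) {3 ℕ.+ toℕ i} (3 ↑ʳ j) act))))))
            (ratio-gap n (1≤scale (cell i)))
          where
          open Extension i
          n = scale (cell i)
          0≤δ = <⇒≤ 0<δ
          -- Behind the three auxiliary points, point i has rank 3 + i: it is the oldest active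
          -- point at `before` and has just expired at `after`.
          before = expires W 0<W δ 0<δ A adheres (2 ℕ.+ toℕ i)
          after = expires W 0<W δ 0<δ A adheres (3 ℕ.+ toℕ i)
          k-nonempty : Fin k
          k-nonempty = κ ↑ʳ zero
          h : Fin (3 ℕ.+ (N ℕ.+ M)) → Point d
          h = prefixed old ++ (embed ∘ new)
          h-lattice : ∀ j → h (3 ↑ʳ j) ≡ embed (all j)
          h-lattice j with splitAt N j
          ... | inj₁ _ = ≡.refl
          ... | inj₂ _ = ≡.refl
          total≤T : 3 ℕ.+ N ℕ.+ M ℕ.≤ T
          total≤T = ℕ.+-monoʳ-≤ (3 ℕ.+ N) (ℕ.+-monoˡ-≤ (k ℕ.* suc z) (Fin.toℕ<n (spot i)))
          spread : HasSpread (stream δ 0≤δ (3 ℕ.+ (N ℕ.+ M)) h) σ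
          spread = has-spread δ 0≤δ h all h-lattice σ ≡.refl ≡.refl ≡.refl
            all-separated (2≤all 1≤z) (λ j a → <extent (all< j a)) 2≤σ

        space-≥ : ∀ {s} → SpaceBound σ A s → N ℕ.≤ s
        space-≥ bound = ℕ.≤-trans
          (every-expiration-used W 0<W δ 0<δ A adheres (prefixed old) N (3 ↑ʳ_)
            (Fin.toℕ-injective ∘ ℕ.+-cancelˡ-≡ 3 _ _) used)
          (bound P₀ spread₀ t*)

-- Numerical estimates and the choice of ℓ and J.

-- The factor 2d comes from k ≤ 2d(κ + 1), the factor 10 from log σ ≤ 10(J + 1), and 16^d from 1 ≤
-- 16εℓ.
constant : ℕ → ℕ
constant d = d ℕ.* 20 ℕ.* 16 ℕ.^ d

^-distribʳ-* : ∀ x y n → (x ℕ.* y) ℕ.^ n ≡ x ℕ.^ n ℕ.* y ℕ.^ n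
^-distribʳ-* x y zero    = ≡.refl
^-distribʳ-* x y (suc n) = ≡.trans (≡.cong (x ℕ.* y ℕ.*_) (^-distribʳ-* x y n))
  (ℕ.[m*n]*[o*p]≡[m*o]*[n*p] x y (x ℕ.^ n) (y ℕ.^ n))

volume-bound : ∀ {x B K k} L t z → x ℕ.≤ K ℕ.* (L ℕ.* t) ℕ.* 31 → B ℕ.≤ z ℕ.+ (z ℕ.+ z) → K ℕ.≤ k →
  x ℕ.* B ℕ.≤ t ℕ.* 16 ℕ.* (k ℕ.* z) ℕ.* (L ℕ.* 8)
volume-bound {x} {B} {K} {k} L t z x≤ B≤ K≤k = begin
  x ℕ.* B                                       ≤⟨ ℕ.*-mono-≤ x≤ B≤ ⟩
  -- Compares 31 · 3 with 16 · 8; the slack is 35.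
  K ℕ.* (L ℕ.* t) ℕ.* 31 ℕ.* (z ℕ.+ (z ℕ.+ z)) ≤⟨ ≤-by (K ℕ.* (L ℕ.* t) ℕ.* z ℕ.* 35) (slack K L t z) ⟩
  t ℕ.* 16 ℕ.* (K ℕ.* z) ℕ.* (L ℕ.* 8)         ≤⟨ ℕ.*-monoˡ-≤ (L ℕ.* 8) (ℕ.*-monoʳ-≤ (t ℕ.* 16) (ℕ.*-monoˡ-≤ z K≤k)) ⟩
  t ℕ.* 16 ℕ.* (k ℕ.* z) ℕ.* (L ℕ.* 8)         ∎
  where
  open ℕ.≤-Reasoning
  slack : ∀ K L t z → K ℕ.* (L ℕ.* t) ℕ.* 31 ℕ.* (z ℕ.+ (z ℕ.+ z)) ℕ.+ K ℕ.* (L ℕ.* t) ℕ.* z ℕ.* 35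
    ≡ t ℕ.* 16 ℕ.* (K ℕ.* z) ℕ.* (L ℕ.* 8)
  slack = solve-∀

sites-bound : ∀ {K} ℓ {t} → 1 ℕ.≤ K → 1 ℕ.≤ t →
  suc (K ℕ.* (suc (suc (ℓ ℕ.* t ℕ.* 8 ℕ.+ t ℕ.* 8)) ℕ.* 3)) ℕ.≤ K ℕ.* (suc ℓ ℕ.* t) ℕ.* 31
sites-bound {K} ℓ {t} 1≤K 1≤t = begin
  1 ℕ.+ K ℕ.* (suc (suc (ℓ ℕ.* t ℕ.* 8 ℕ.+ t ℕ.* 8)) ℕ.* 3) ≡⟨ expand K ℓ t ⟩
  1 ℕ.+ K ℕ.* 6 ℕ.+ P ℕ.* 24                             ≤⟨ ℕ.+-monoˡ-≤ (P ℕ.* 24) (ℕ.+-mono-≤ (ℕ.≤-trans 1≤K K≤P) (ℕ.*-monoˡ-≤ 6 K≤P)) ⟩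
  P ℕ.+ P ℕ.* 6 ℕ.+ P ℕ.* 24                             ≡⟨ collect P ⟩
  P ℕ.* 31                                               ∎
  where
  open ℕ.≤-Reasoning
  P = K ℕ.* (suc ℓ ℕ.* t)
  K≤P : K ℕ.≤ P
  K≤P = ℕ.≤-trans (ℕ.≤-reflexive (≡.sym (ℕ.*-identityʳ K))) (ℕ.*-monoʳ-≤ K (ℕ.≤-trans 1≤t (ℕ.m≤m+n t (ℓ ℕ.* t))))
  expand : ∀ K ℓ t → 1 ℕ.+ K ℕ.* (suc (suc (ℓ ℕ.* t ℕ.* 8 ℕ.+ t ℕ.* 8)) ℕ.* 3) ≡ 1 ℕ.+ K ℕ.* 6 ℕ.+ K ℕ.* (suc ℓ ℕ.* t) ℕ.* 24
  expand = solve-∀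
  collect : ∀ P → P ℕ.+ P ℕ.* 6 ℕ.+ P ℕ.* 24 ≡ P ℕ.* 31
  collect = solve-∀

count-bound : ∀ d κ z J ℓ {k} → k ℕ.≤ d ℕ.* 2 ℕ.* suc κ →
  k ℕ.* z ℕ.* (suc J ℕ.* 10) ℕ.* (ℓ ℕ.* 16) ℕ.^ d ℕ.≤ (suc J ℕ.* (suc κ ℕ.* ℓ ℕ.^ d)) ℕ.* z ℕ.* constant d
count-bound d κ z J ℓ {k} k≤ = begin
  k ℕ.* z ℕ.* (suc J ℕ.* 10) ℕ.* (ℓ ℕ.* 16) ℕ.^ d
    ≤⟨ ℕ.*-monoˡ-≤ ((ℓ ℕ.* 16) ℕ.^ d) (ℕ.*-monoˡ-≤ (suc J ℕ.* 10) (ℕ.*-monoˡ-≤ z k≤)) ⟩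
  d ℕ.* 2 ℕ.* suc κ ℕ.* z ℕ.* (suc J ℕ.* 10) ℕ.* (ℓ ℕ.* 16) ℕ.^ d
    ≡⟨ ≡.cong (d ℕ.* 2 ℕ.* suc κ ℕ.* z ℕ.* (suc J ℕ.* 10) ℕ.*_) (^-distribʳ-* ℓ 16 d) ⟩
  d ℕ.* 2 ℕ.* suc κ ℕ.* z ℕ.* (suc J ℕ.* 10) ℕ.* (ℓ ℕ.^ d ℕ.* 16 ℕ.^ d)
    ≡⟨ eq d (suc κ) z (suc J) (ℓ ℕ.^ d) (16 ℕ.^ d) ⟩
  (suc J ℕ.* (suc κ ℕ.* ℓ ℕ.^ d)) ℕ.* z ℕ.* constant d ∎
  where
  open ℕ.≤-Reasoning
  eq : ∀ d K z J a b → d ℕ.* 2 ℕ.* K ℕ.* z ℕ.* (J ℕ.* 10) ℕ.* (a ℕ.* b) ≡ J ℕ.* (K ℕ.* a) ℕ.* z ℕ.* (d ℕ.* 20 ℕ.* b)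
  eq = solve-∀

module Parameters (ℝ : RealField) where

  open Construction ℝ public

  reciprocal-≥ : ∀ {ε x} → 0# < ε → ε * x ≤ 1# → x ≤ ε ⁻¹
  reciprocal-≥ {ε} {x} 0<ε h = *-cancelʳ-≤ 0<ε (≤-resp (*-comm ε x) (sym (trans (*-comm _ ε) (*-inverse 0<ε))) h)

  module _ {ε : Carrier} (0<ε : 0# < ε) (ε≤ : ε ≤ fromℕ 1 / fromℕ 24) where

    ε*24≤1 : ε * fromℕ 24 ≤ 1#
    ε*24≤1 = ≤-resp refl (trans (x/z*z≈x (fromℕ-pos {24} (ℕ.s≤s ℕ.z≤n))) fromℕ-1)
      (*-monoˡ-≤ (fromℕ-nonneg 24) ε≤)

    -- With ℓ = 2 + j, the search starts from 24ε ≤ 1 and stops where 8(ℓ + 1)ε ≤ 1 holds for ℓ but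
    -- not for ℓ + 1. Then 1 ≤ 8(ℓ + 2)ε ≤ 16ℓε, because ℓ ≥ 2.
    grid-side : ∃[ j ] ε * fromℕ ((3 ℕ.+ j) ℕ.* 8) ≤ 1# × 1# ≤ ε * fromℕ ((2 ℕ.+ j) ℕ.* 16)
    grid-side = let j , fits , tight = last-true {P = Fits} (λ j → _ ≤? _) ε*24≤1 n exceeds in
        j , fits , ≤-trans (≰⇒≥ tight) (*-monoʳ-≤ (<⇒≤ 0<ε) (fromℕ-mono-≤ (≤-by (j ℕ.* 8) (eq j))))
      where
      Fits : ℕ → Set
      Fits j = ε * fromℕ ((3 ℕ.+ j) ℕ.* 8) ≤ 1#
      n = proj₁ (archimedean (ε ⁻¹))
      exceeds : ¬ Fits n
      exceeds h = ℕ.<⇒≱ (ℕ.m<n+m n {3} (ℕ.s≤s ℕ.z≤n)) (ℕ.≤-trans (ℕ.m≤m*n (3 ℕ.+ n) 8) (fromℕ-cancel-≤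
        (≤-trans (reciprocal-≥ 0<ε h) (proj₂ (archimedean (ε ⁻¹))))))
      eq : ∀ j → (3 ℕ.+ suc j) ℕ.* 8 ℕ.+ j ℕ.* 8 ≡ (2 ℕ.+ j) ℕ.* 16
      eq = solve-∀

    module _ {m : ℕ} (1≤m : 1 ℕ.≤ m) {σ : Carrier} (u²≤σ : (fromℕ m / ε) ^ 2 ≤ σ) where

      private
        u = fromℕ m / ε

      16≤u : fromℕ 16 ≤ u
      16≤u = ≤-resp (*-identityˡ _) refl (*-mono-≤ 0≤1 (⁻¹-nonneg 0<ε) (≤-resp fromℕ-1 refl (fromℕ-mono-≤ 1≤m))
        (≤-trans (fromℕ-mono-≤ (ℕ.m≤m+n 16 8)) (reciprocal-≥ 0<ε ε*24≤1)))

      0≤u : 0# ≤ u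
      0≤u = ≤-trans (fromℕ-nonneg 16) 16≤u

      u*u≤σ : u * u ≤ σ
      u*u≤σ = ≤-resp (*-congˡ (*-identityʳ u)) refl u²≤σ

      -- J is the last scale exponent for which the extent is sure to fit below σ. That J = 0
      -- qualifies follows from 16 ≤ u and u² ≤ σ; failure at J + 1 gives the factor 16 · 2^(J + 1)
      -- = 2^(5 + J).
      top-scale : ∃[ J ] fromℕ (2 ℕ.^ J ℕ.* 16) * u ≤ σ × σ < fromℕ (2 ℕ.^ (5 ℕ.+ J)) * u
      top-scale = let J , fits , tight = last-true {P = Fits} (λ j → _ ≤? _) (≤-trans (*-monoˡ-≤ 0≤u 16≤u) u*u≤σ) n exceeds in
          J , fits , <-≤-trans (≰⇒> tight) (≤-reflexive (*-congʳ (reflexive (≡.cong fromℕ (shift J)))))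
        where
        Fits : ℕ → Set
        Fits j = fromℕ (2 ℕ.^ j ℕ.* 16) * u ≤ σ
        n = proj₁ (archimedean σ)
        shift : ∀ j → 2 ℕ.^ suc j ℕ.* 16 ≡ 2 ℕ.^ (5 ℕ.+ j)
        shift j = ≡.trans (≡.cong (ℕ._* 16) (ℕ.*-comm 2 (2 ℕ.^ j))) (≡.trans (ℕ.*-assoc (2 ℕ.^ j) 2 16)
          (≡.trans (≡.sym (ℕ.^-distribˡ-+-* 2 j 5)) (≡.cong (2 ℕ.^_) (ℕ.+-comm j 5))))
        exceeds : ¬ Fits n
        exceeds h = ℕ.<⇒≱ (ℕ.<-≤-trans (n<2^n n) (ℕ.m≤m*n (2 ℕ.^ n) 16)) (fromℕ-cancel-≤ (≤-trans
          (≤-resp (*-identityʳ _) refl (*-monoʳ-≤ (fromℕ-nonneg (2 ℕ.^ n ℕ.* 16))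
            (≤-trans (≤-resp fromℕ-1 refl (fromℕ-mono-≤ (ℕ.m≤m+n 1 15))) 16≤u)))
          (≤-trans h (proj₂ (archimedean σ)))))

      -- Either u ≤ 2^a, and σ < 2^a u ≤ 2^(2a), or 2^a ≤ u, and σ < 2^a u ≤ u² contradicts u² ≤ σ.
      -- Here the lower bound on σ turns the number of scales into a fraction of log σ.
      σ<2^2a : ∀ a → σ < fromℕ (2 ℕ.^ a) * u → ¬ fromℕ (2 ℕ.^ (a ℕ.+ a)) ≤ σ
      σ<2^2a a σ< h with total u (fromℕ (2 ℕ.^ a))
      ... | inj₁ u≤ = <⇒≱ σ< (≤-trans (*-monoʳ-≤ (fromℕ-nonneg (2 ℕ.^ a)) u≤)
        (≤-resp (trans (reflexive (≡.cong fromℕ (ℕ.^-distribˡ-+-* 2 a a))) (fromℕ-* (2 ℕ.^ a) (2 ℕ.^ a))) refl h))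
      ... | inj₂ ≤u = <⇒≱ σ< (≤-trans (*-monoˡ-≤ 0≤u ≤u) u*u≤σ)

      log-bound : ∀ {L} → IsLog₂ σ L → ∀ r → ¬ fromℕ (2 ℕ.^ r) ≤ σ → L ≤ fromℕ r
      log-bound {L} isLog r σ≱ = ≰⇒≥ λ r≤L → σ≱ (≤-resp (sym (fromℕ-^ 2 r)) (trans (*-identityˡ _) (*-identityʳ σ))
        (Equivalence.from (isLog r 0 1 (ℕ.s≤s ℕ.z≤n))
          (≤-resp refl (sym (trans (+-identityˡ _) (trans (*-congʳ fromℕ-1) (*-identityˡ L)))) r≤L)))

  module _ (e κ z : ℕ) (1≤z : 1 ℕ.≤ z) where

    private
      d = suc e
      k = κ ℕ.+ (d ℕ.+ d)

    1≤kz : 1 ℕ.≤ k ℕ.* z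
    1≤kz = ℕ.*-mono-≤ (ℕ.≤-trans (ℕ.s≤s ℕ.z≤n) (ℕ.m≤n+m (d ℕ.+ d) κ)) 1≤z

    K≤k : suc κ ℕ.≤ k
    K≤k = ℕ.≤-trans (ℕ.≤-reflexive (ℕ.+-comm 1 κ)) (ℕ.+-monoʳ-≤ κ (ℕ.s≤s ℕ.z≤n))

    k≤2dK : k ℕ.≤ d ℕ.* 2 ℕ.* suc κ
    k≤2dK = ≤-by (κ ℕ.* suc (e ℕ.* 2)) (eq κ e)
      where
      eq : ∀ κ e → κ ℕ.+ (suc e ℕ.+ suc e) ℕ.+ κ ℕ.* suc (e ℕ.* 2) ≡ suc e ℕ.* 2 ℕ.* suc κ
      eq = solve-∀

    extent≤σ : ∀ {ε σ ℓ J} → 0# < ε → ε * fromℕ (suc ℓ ℕ.* 8) ≤ 1# → fromℕ (2 ℕ.^ J ℕ.* 16) * (fromℕ (k ℕ.* z) / ε) ≤ σ →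
      fromℕ (Elements.extent e ℓ κ J z) ≤ σ
    extent≤σ {ε} {σ} {ℓ} {J} 0<ε fits h = begin
      fromℕ (Elements.extent e ℓ κ J z)                                ≤⟨ fromℕ-mono-≤ extent≤ ⟩
      fromℕ (2 ℕ.^ J ℕ.* 16 ℕ.* (k ℕ.* z) ℕ.* (suc ℓ ℕ.* 8))     ≈⟨ fromℕ-* (2 ℕ.^ J ℕ.* 16 ℕ.* (k ℕ.* z)) (suc ℓ ℕ.* 8) ⟩
      fromℕ (2 ℕ.^ J ℕ.* 16 ℕ.* (k ℕ.* z)) * fromℕ (suc ℓ ℕ.* 8) ≤⟨ *-monoʳ-≤ (fromℕ-nonneg (2 ℕ.^ J ℕ.* 16 ℕ.* (k ℕ.* z))) (reciprocal-≥ 0<ε fits) ⟩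
      fromℕ (2 ℕ.^ J ℕ.* 16 ℕ.* (k ℕ.* z)) * ε ⁻¹                ≈⟨ *-congʳ (fromℕ-* (2 ℕ.^ J ℕ.* 16) (k ℕ.* z)) ⟩
      fromℕ (2 ℕ.^ J ℕ.* 16) * fromℕ (k ℕ.* z) * ε ⁻¹            ≈⟨ *-assoc _ _ _ ⟩
      fromℕ (2 ℕ.^ J ℕ.* 16) * (fromℕ (k ℕ.* z) / ε)             ≤⟨ h ⟩
      σ                                                           ∎
      where
      extent≤ : Elements.extent e ℓ κ J z ℕ.≤ 2 ℕ.^ J ℕ.* 16 ℕ.* (k ℕ.* z) ℕ.* (suc ℓ ℕ.* 8)
      extent≤ = volume-bound (suc ℓ) (2 ℕ.^ J) z (sites-bound {suc κ} ℓ (ℕ.s≤s ℕ.z≤n) (ℕ.m^n>0 2 J))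
        (ℕ.+-monoˡ-≤ (z ℕ.+ z) 1≤z) K≤k

    rate-bound : ∀ {ε L ℓ J s} → 0# < ε → 1# ≤ ε * fromℕ (ℓ ℕ.* 16) → L ≤ fromℕ (suc J ℕ.* 10) → Elements.N e ℓ κ J z ℕ.≤ s →
      fromℕ (k ℕ.* z) * L ≤ fromℕ s * (fromℕ (constant d) * ε ^ d)
    rate-bound {ε} {L} {ℓ} {J} {s} 0<ε fine L≤ N≤s = begin
      fromℕ (k ℕ.* z) * L                             ≤⟨ *-monoʳ-≤ (fromℕ-nonneg (k ℕ.* z)) L≤ ⟩
      fromℕ (k ℕ.* z) * fromℕ (suc J ℕ.* 10)          ≈⟨ fromℕ-* (k ℕ.* z) (suc J ℕ.* 10) ⟨
      fromℕ (k ℕ.* z ℕ.* (suc J ℕ.* 10))              ≈⟨ *-identityʳ _ ⟨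
      -- The factor (16ℓε)^d ≥ 1 brings in ε^d and the number ℓ^d of cells of a grid.
      fromℕ X * 1#                                    ≤⟨ *-monoʳ-≤ (fromℕ-nonneg X) (1≤x⇒1≤x^n fine d) ⟩
      fromℕ X * (ε * fromℕ (ℓ ℕ.* 16)) ^ d            ≈⟨ *-congˡ (trans (^-distrib-* ε (fromℕ (ℓ ℕ.* 16)) d) (trans (*-comm _ _) (*-congʳ (sym (fromℕ-^ (ℓ ℕ.* 16) d))))) ⟩
      fromℕ X * (fromℕ ((ℓ ℕ.* 16) ℕ.^ d) * ε ^ d)    ≈⟨ *-assoc _ _ _ ⟨
      fromℕ X * fromℕ ((ℓ ℕ.* 16) ℕ.^ d) * ε ^ d      ≈⟨ *-congʳ (fromℕ-* X ((ℓ ℕ.* 16) ℕ.^ d)) ⟨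
      fromℕ (X ℕ.* (ℓ ℕ.* 16) ℕ.^ d) * ε ^ d          ≤⟨ *-monoˡ-≤ (^-nonneg (<⇒≤ 0<ε) d) (fromℕ-mono-≤ (count-bound d κ z J ℓ k≤2dK)) ⟩
      fromℕ (Elements.N e ℓ κ J z ℕ.* constant d) * ε ^ d        ≤⟨ *-monoˡ-≤ (^-nonneg (<⇒≤ 0<ε) d) (fromℕ-mono-≤ (ℕ.*-monoˡ-≤ (constant d) N≤s)) ⟩
      fromℕ (s ℕ.* constant d) * ε ^ d                ≈⟨ *-congʳ (fromℕ-* s (constant d)) ⟩
      fromℕ s * fromℕ (constant d) * ε ^ d            ≈⟨ *-assoc _ _ _ ⟩
      fromℕ s * (fromℕ (constant d) * ε ^ d)          ∎
      where
      X = k ℕ.* z ℕ.* (suc J ℕ.* 10)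

  0<constant : ∀ e → 0# < fromℕ (constant (suc e))
  0<constant e = fromℕ-pos {constant (suc e)} (ℕ.*-mono-≤ {1} {suc e ℕ.* 20} (ℕ.s≤s ℕ.z≤n) (ℕ.m^n>0 16 (suc e)))

  normalise : ∀ {C x E L s} → 0# < C → 0# < E → x * L ≤ s * (C * E) → C ⁻¹ * (x / E) * L ≤ s
  normalise {C} {x} {E} {L} {s} 0<C 0<E h = *-cancelʳ-≤ (*-pos 0<C 0<E) (begin
    C ⁻¹ * (x * E ⁻¹) * L * (C * E)       ≈⟨ solve 6 (λ C C⁻¹ E E⁻¹ x L → C⁻¹ :* (x :* E⁻¹) :* L :* (C :* E) := x :* L :* ((C :* C⁻¹) :* (E :* E⁻¹))) refl C (C ⁻¹) E (E ⁻¹) x L ⟩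
    x * L * ((C * C ⁻¹) * (E * E ⁻¹))     ≈⟨ *-congˡ (trans (*-cong (*-inverse 0<C) (*-inverse 0<E)) (*-identityʳ 1#)) ⟩
    x * L * 1#                            ≈⟨ *-identityʳ _ ⟩
    x * L                                 ≤⟨ h ⟩
    s * (C * E)                           ∎)

theorem30 :
    (ℝ : RealField) →
    let open RealField ℝ
        open SlidingWindow ℝ
    in
    (d : ℕ) → d ℕ.≥ 1 →
    ∃[ c ] 0# < c ×
      (∀ (k z : ℕ) (ε σ W logσ : Carrier) →
        k ℕ.≥ 2 ℕ.* d →
        0# < ε → ε ≤ fromℕ 1 / fromℕ 24 →
        (fromℕ (k ℕ.* z) / ε) ^ 2 ≤ σ →
        IsLog₂ σ logσ →
        0# < W →
        (A : Algorithm d) → Adheres W A → Solves σ A W k z ε →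
        (s : ℕ) → SpaceBound σ A s →
        c * (fromℕ (k ℕ.* z) / ε ^ d) * logσ ≤ fromℕ s)
theorem30 ℝ (suc e) _ = fromℕ (constant d) ⁻¹ , ⁻¹-pos (0<constant e) , bound
  where
  open Parameters ℝ
  d = suc e
  bound : ∀ (k z : ℕ) (ε σ W logσ : Carrier) → k ℕ.≥ 2 ℕ.* d → 0# < ε → ε ≤ fromℕ 1 / fromℕ 24 →
    (fromℕ (k ℕ.* z) / ε) ^ 2 ≤ σ → IsLog₂ σ logσ → 0# < W →
    (A : Algorithm d) → Adheres W A → Solves σ A W k z ε → (s : ℕ) → SpaceBound σ A s →
    fromℕ (constant d) ⁻¹ * (fromℕ (k ℕ.* z) / ε ^ d) * logσ ≤ fromℕ s
  -- For z = 0 the claimed bound is zero; the construction needs z ≥ 1.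
  bound k zero ε σ W logσ k≥2d 0<ε ε≤ u²≤σ isLog 0<W A adheres solves s space
    rewrite ℕ.*-zeroʳ k = ≤-trans (≤-reflexive (trans (*-congʳ (trans (*-congˡ (zeroˡ _)) (zeroʳ _))) (zeroˡ logσ))) (fromℕ-nonneg s)
  bound k z@(suc _) ε σ W logσ k≥2d 0<ε ε≤ u²≤σ isLog 0<W A adheres solves s space
    -- Of the k boxes, 2d surround a cell and the remaining κ cover one further tower each, which
    -- allows for κ + 1 towers.
    with κ , 2d+κ≡k ← ℕ.m≤n⇒∃[o]m+o≡n k≥2d
    with ≡.refl ← ≡.trans (≡.sym 2d+κ≡k) (≡.trans (ℕ.+-comm (2 ℕ.* d) κ) (≡.cong (λ x → κ ℕ.+ (d ℕ.+ x)) (ℕ.+-identityʳ d)))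
    = normalise (0<constant e) (^-pos 0<ε d)
        (rate-bound e κ z 1≤z {ℓ = suc (suc j)} {J} 0<ε fine log≤
          (space-≥ e (suc (suc j)) κ J z 1≤z ε σ W 0<ε 0<W coarse
            (extent≤σ e κ z 1≤z {ℓ = suc (suc j)} {J} 0<ε coarse fits) A adheres solves space))
    where
    1≤z : 1 ℕ.≤ z
    1≤z = ℕ.s≤s ℕ.z≤n
    m≥1 = 1≤kz e κ z 1≤z
    side-j = grid-side 0<ε ε≤
    j = proj₁ side-j
    coarse = proj₁ (proj₂ side-j)
    fine = proj₂ (proj₂ side-j)
    top = top-scale 0<ε ε≤ m≥1 u²≤σ
    J = proj₁ top
    fits = proj₁ (proj₂ top)
    log≤ : logσ ≤ fromℕ (suc J ℕ.* 10)
    log≤ = ≤-trans (log-bound 0<ε ε≤ m≥1 u²≤σ isLog (5 ℕ.+ J ℕ.+ (5 ℕ.+ J)) (σ<2^2a 0<ε ε≤ m≥1 u²≤σ (5 ℕ.+ J) (proj₂ (proj₂ top))))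
      (fromℕ-mono-≤ (≤-by (J ℕ.* 8) (eq J)))
      where
      eq : ∀ J → 5 ℕ.+ J ℕ.+ (5 ℕ.+ J) ℕ.+ J ℕ.* 8 ≡ suc J ℕ.* 10
      eq = solve-∀
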